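{- Let $3\leq k\leq 10$. Then for every positive integer $n$ such that $nk\equiv 0$ or $3 \pmod 4$ there exist a pair of orthogonal cyclic $k$-cycle decompositions of the complete graph $K_{2nk+1}$ and a pair of orthogonal cyclic $k$-cycle decompositions of the cocktail party graph of order $2nk+2$.
   Context: A $k$-cycle decomposition of a graph $\Gamma$ is a set $\mathcal C$ of $k$-cycles of $\Gamma$ such that every edge of $\Gamma$ lies in exactly one cycle of $\mathcal C$. If $\Gamma$ has $v$ vertices, the decomposition is cyclic if (up to isomorphism) the vertex set is $\mathbb{Z}_v$ and for every cycle $(c_1,\dots,c_k)\in\mathcal C$ also $(c_1+1,\dots,c_k+1)\in\mathcal C$ (i.e. $\mathbb{Z}_v$ acts sharply transitively on the vertices as an automorphism group). Two $k$-cycle decompositions $\mathcal C,\mathcal C'$ of the same graph are orthogonal if every cycle of $\mathcal C$ and every cycle of $\mathcal C'$ share at most one edge. The cocktail party graph of order $2t$ is $K_{2t}-I$, the complete graph on $\mathbb{Z}_{2t}$ minus the 1-factor $I$ with edges $[i,i+t]$, $i=0,\dots,t-1$. -}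

module Defs where

open import Data.Nat using (ℕ; zero; suc; _+_; _*_; _∸_; _%_)
open import Data.Nat.DivMod using (m%n<n)
open import Data.Fin using (Fin; toℕ; fromℕ<)
open import Data.List using (List; length; lookup)
open import Data.Product using (Σ; ∃; ∃-syntax; _×_; _,_)
open import Data.Sum using (_⊎_)
open import Relation.Binary.PropositionalEquality using (_≡_; _≢_)
open import Function.Definitions using (Injective)

_+ₘ_ : ∀ {n} → Fin n → ℕ → Fin n
_+ₘ_ {suc m} i a = fromℕ< (m%n<n (toℕ i + a) (suc m))

reflectₘ : ∀ {n} → Fin n → Fin n → Fin n
reflectₘ {n} r i = r +ₘ (n ∸ toℕ i)

-- A graph on vertex set ℤ_v given by its (symmetric) adjacency relation.
Graph : ℕ → Set₁
Graph v = Fin v → Fin v → Set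

Complete : (v : ℕ) → Graph v
Complete v x y = x ≢ y

CocktailParty : (t : ℕ) → Graph (2 * t)
CocktailParty t x y = x ≢ y × y ≢ x +ₘ t

-- A closed walk of length k on ℤ_v given by (c_0, …, c_{k-1});
-- it is a k-cycle when the c_i are pairwise distinct (and k ≥ 3).
Walk : ℕ → ℕ → Set
Walk v k = Fin k → Fin v

IsCycle : ∀ {v k} → Walk v k → Set
IsCycle c = Injective _≡_ _≡_ c

EdgeIn : ∀ {v k} → Walk v k → Fin v → Fin v → Set
EdgeIn {v} {k} c x y =
  ∃[ i ] ((c i ≡ x × c (i +ₘ 1) ≡ y) ⊎ (c i ≡ y × c (i +ₘ 1) ≡ x))

SameEdge : ∀ {v} → Fin v → Fin v → Fin v → Fin v → Set
SameEdge x y x' y' = (x ≡ x' × y ≡ y') ⊎ (x ≡ y' × y ≡ x')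

SameCycle : ∀ {v k} → Walk v k → Walk v k → Set
SameCycle {v} {k} c c' =
  ∃[ r ] ((∀ i → c' i ≡ c (i +ₘ toℕ r)) ⊎ (∀ i → c' i ≡ c (reflectₘ r i)))

translate : ∀ {v k} → Walk v k → Walk v k
translate c i = c i +ₘ 1

IsCycleOf : ∀ {v k} → Graph v → Walk v k → Set
IsCycleOf {v} {k} Γ c = IsCycle c × (∀ x y → EdgeIn c x y → Γ x y)

IsDecomposition : ∀ {v} (k : ℕ) → Graph v → List (Walk v k) → Set
IsDecomposition {v} k Γ 𝒞 =
  (∀ j → IsCycleOf Γ (lookup 𝒞 j)) ×
  (∀ x y → Γ x y →
     ∃[ j ] (EdgeIn (lookup 𝒞 j) x y × (∀ j' → EdgeIn (lookup 𝒞 j') x y → j' ≡ j)))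

IsCyclic : ∀ {v k} → List (Walk v k) → Set
IsCyclic 𝒞 = ∀ j → ∃[ j' ] SameCycle (lookup 𝒞 j') (translate (lookup 𝒞 j))

CyclicDecomposition : ∀ {v} (k : ℕ) → Graph v → List (Walk v k) → Set
CyclicDecomposition k Γ 𝒞 = IsDecomposition k Γ 𝒞 × IsCyclic 𝒞

Orthogonal : ∀ {v k} → List (Walk v k) → List (Walk v k) → Set
Orthogonal 𝒞 𝒞' = ∀ j j' x y x' y' →
  EdgeIn (lookup 𝒞 j) x y → EdgeIn (lookup 𝒞' j') x y →
  EdgeIn (lookup 𝒞 j) x' y' → EdgeIn (lookup 𝒞' j') x' y' →
  SameEdge x y x' y'

HasOrthogonalCyclicPair : ∀ {v} (k : ℕ) → Graph v → Set
HasOrthogonalCyclicPair {v} k Γ =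
  Σ (List (Walk v k)) λ 𝒞 → Σ (List (Walk v k)) λ 𝒞' →
    CyclicDecomposition k Γ 𝒞 × CyclicDecomposition k Γ 𝒞' × Orthogonal 𝒞 𝒞'

{-# OPTIONS --safe #-}
-- The cycles of 𝒞 are the translates modulo v of n base cycles whose nk edge differences are,
-- up to sign, exactly 1, …, nk; those of 𝒞′ are the translates of the negatives of the same base
-- cycles. An edge shared by c + a and − c′ + b forces c = c′, and if its ends are the translates
-- by a of the consecutive vertices c_p, c_{p+1}, then c_p + c_{p+1} ≡ b − a. Hence 𝒞 and 𝒞′ are
-- orthogonal as soon as the sums of consecutive vertices of each base cycle are distinct modulo v.
-- As the base cycles are closed over ℤ, one choice serves both v = 2nk + 1 and v = 2nk + 2.
module Submission where

open import Defs
open import Data.Nat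
  using (ℕ; zero; suc; _+_; _*_; _∸_; _⊔_; _%_; _/_; _≤_; _<_; z≤n; s≤s)
import Data.Nat.Properties as ℕ
import Data.Nat.Divisibility as ℕ
import Data.Nat.Tactic.RingSolver as ℕSolver
open import Data.Nat.DivMod
  using (_divMod_; result; m≡m%n+[m/n]*n; m%n<n; m<n*o⇒m/o<n; [m+kn]%n≡m%n)
open import Data.Integer using (ℤ; +_; -[1+_]; -_; ∣_∣; 0ℤ)
  renaming (_+_ to _+ᶻ_; _-_ to _-ᶻ_; _*_ to _*ᶻ_)
import Data.Integer.Properties as ℤ
open import Data.Integer.DivMod using (_%ℕ_; _/ℕ_; n%ℕd<d; a≡a%ℕn+[a/ℕn]*n)
open import Data.Integer.Divisibility.Signed
  using (_∣_; divides; ∣-refl; ∣⇒∣ᵤ; ∣m∣n⇒∣m+n; ∣m∣n⇒∣m-n; ∣m⇒∣-m)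
open import Data.Integer.Tactic.RingSolver using (solve-∀)
open import Data.Fin
  using (Fin; zero; toℕ; fromℕ<; remQuot; combine; splitAt; _↑ˡ_; _↑ʳ_; opposite; cast; punchOut; _≟_)
open import Data.Fin.Patterns using (0F; 1F; 2F; 3F)
open import Data.Fin.Properties
  using (toℕ-fromℕ<; toℕ-injective; toℕ<n; any?; all?; injective⇒≤; punchOut-injective;
         remQuot-combine; combine-remQuot; cast-involutive; splitAt-↑ˡ; splitAt-↑ʳ; opposite-prop)
open import Data.List using (List; []; _∷_; _++_; replicate; tabulate; lookup; length)
open import Data.List.Properties using (length-tabulate; lookup-tabulate)
open import Data.Vec using (Vec; []; _∷_)
import Data.Vec as Vec
open import Data.Sum using (_⊎_; inj₁; inj₂; [_,_]′; map; map₂)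
open import Data.Product using (∃₂; ∃-syntax; _×_; _,_; proj₁; proj₂; uncurry)
open import Data.Product.Properties using (≡-dec)
open import Function using (_∘_)
open import Function.Definitions using (Injective)
open import Relation.Binary.Definitions using (DecidableEquality; Tri; tri<; tri≈; tri>)
open import Relation.Nullary using (Dec; yes; no; contradiction)
open import Relation.Nullary.Decidable using (_×-dec_; _⊎-dec_; True; toWitness)
open import Relation.Binary.PropositionalEquality
  using (_≡_; _≢_; refl; sym; trans; cong; cong₂; subst; module ≡-Reasoning)

-- Closure over ℤ accounts for the congruence condition: the signed differences of each base cycle
-- sum to 0, so 1 + ... + nk must be even, that is, nk ≡ 0 or 3 (mod 4). The obstacle is that `n` is
-- unbounded. For each `k` and each class of `n` the base cycles therefore come from finitely many
-- rows, whose vertices are linear forms with natural coefficients in a parameter `r` and its mirror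
-- image `r′`. One finite check of coefficients then settles infinitely many `n`. Two reductions
-- make this possible. Distinctness modulo `v` is replaced by distinctness over ℤ together with the
-- bound 2nk < v on the gaps. And each difference is only required to occur: nk steps that hit all
-- of 1, ..., nk leave no room for a repetition or for 0. The two graphs enter only as circulant
-- graphs with connection set ±1, ..., ±nk. Modulo 2nk + 1 these are all nonzero differences; modulo
-- 2nk + 2 the one left out is nk + 1, which is the difference of the 1-factor.

injective⇒surjective : ∀ {n} {f : Fin n → Fin n} → Injective _≡_ _≡_ f → ∀ y → ∃[ x ] f x ≡ y
injective⇒surjective {suc n} {f} inj y with any? (λ x → f x ≟ y)
... | yes hit = hit
... | no miss = contradiction
  (injective⇒≤ {f = λ x → punchOut (avoid x)} λ {a} {b} eq →
    inj (punchOut-injective (avoid a) (avoid b) eq))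
  ℕ.1+n≰n
  where
  avoid : ∀ x → y ≢ f x
  avoid x eq = miss (x , sym eq)

-- Counting: `N` arguments for `N` values. A starter can thus be certified by one occurrence of each
-- difference; that none vanishes, repeats or exceeds `N` follows.
onto-range⇒bijective : ∀ {N} (f : Fin N → ℕ) → (∀ d → 1 ≤ d → d ≤ N → ∃[ z ] f z ≡ d) →
  (∀ z → 1 ≤ f z × f z ≤ N) × Injective _≡_ _≡_ f
onto-range⇒bijective {N} f onto =
  (λ z → let d , eq = hit z in subst (λ h → 1 ≤ h × h ≤ N) (sym eq) (s≤s z≤n , toℕ<n d)) ,
  λ {z} {z′} fz≡fz′ →
    let d , eq , g = section z ; d′ , eq′ , g′ = section z′
        d≡d′ = toℕ-injective (ℕ.suc-injective (trans (sym eq) (trans fz≡fz′ eq′)))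
    in trans (sym g) (trans (cong preimage d≡d′) g′)
  where
  preimage : Fin N → Fin N
  preimage d = proj₁ (onto (suc (toℕ d)) (s≤s z≤n) (toℕ<n d))

  f-preimage : ∀ d → f (preimage d) ≡ suc (toℕ d)
  f-preimage d = proj₂ (onto (suc (toℕ d)) (s≤s z≤n) (toℕ<n d))

  section : ∀ z → ∃[ d ] (f z ≡ suc (toℕ d) × preimage d ≡ z)
  -- A choice of preimages is an injective self-map of a finite set, hence onto, so it is a
  -- two-sided inverse.
  section z with injective⇒surjective preimage-injective z
    where
    preimage-injective : Injective _≡_ _≡_ preimage
    preimage-injective {a} {b} eq = toℕ-injective
      (ℕ.suc-injective (trans (sym (f-preimage a)) (trans (cong f eq) (f-preimage b))))
  ... | d , refl = d , f-preimage d , refl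

  hit : ∀ z → ∃[ d ] f z ≡ suc (toℕ d)
  hit z = let d , eq , _ = section z in d , eq

-- Integers modulo `v`

module Residues (w : ℕ) where

  v : ℕ
  v = suc w

  infix 4 _≈_
  -- A record rather than an abbreviation for the divisibility: `a` and `b` remain inferable from
  -- the type, as they would not be from `a -ᶻ b`.
  record _≈_ (a b : ℤ) : Set where
    constructor congruent
    field v∣difference : + v ∣ a -ᶻ b

  ⟦_⟧ : ℤ → Fin v
  ⟦ z ⟧ = fromℕ< (n%ℕd<d z v)

  ≈-sym : ∀ {a b} → a ≈ b → b ≈ a
  ≈-sym {a} {b} (congruent p) = congruent (subst (+ v ∣_) (eq a b) (∣m⇒∣-m p))
    where
    eq : ∀ a b → - (a -ᶻ b) ≡ b -ᶻ a
    eq = solve-∀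

  ≈-trans : ∀ {a b c} → a ≈ b → b ≈ c → a ≈ c
  ≈-trans {a} {b} {c} (congruent p) (congruent q) =
    congruent (subst (+ v ∣_) (eq a b c) (∣m∣n⇒∣m+n p q))
    where
    eq : ∀ a b c → (a -ᶻ b) +ᶻ (b -ᶻ c) ≡ a -ᶻ c
    eq = solve-∀

  ≈-reflexive : ∀ {a b} → a ≡ b → a ≈ b
  ≈-reflexive {a} refl = congruent (divides 0ℤ (ℤ.+-inverseʳ a))

  ≈-add : ∀ {a b c d} → a ≈ b → c ≈ d → a +ᶻ c ≈ b +ᶻ d
  ≈-add {a} {b} {c} {d} (congruent p) (congruent q) =
    congruent (subst (+ v ∣_) (eq a b c d) (∣m∣n⇒∣m+n p q))
    where
    eq : ∀ a b c d → (a -ᶻ b) +ᶻ (c -ᶻ d) ≡ (a +ᶻ c) -ᶻ (b +ᶻ d)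
    eq = solve-∀

  ≈-sub : ∀ {a b c d} → a ≈ b → c ≈ d → a -ᶻ c ≈ b -ᶻ d
  ≈-sub {a} {b} {c} {d} (congruent p) (congruent q) =
    congruent (subst (+ v ∣_) (eq a b c d) (∣m∣n⇒∣m-n p q))
    where
    eq : ∀ a b c d → (a -ᶻ b) -ᶻ (c -ᶻ d) ≡ (a -ᶻ c) -ᶻ (b -ᶻ d)
    eq = solve-∀

  ≈-+-cancelʳ : ∀ {b c} x → b +ᶻ x ≈ c +ᶻ x → b ≈ c
  ≈-+-cancelʳ {b} {c} x p = ≈-trans (≈-reflexive (eq b x))
    (≈-trans (≈-sub p (≈-reflexive refl)) (≈-reflexive (sym (eq c x))))
    where
    eq : ∀ b x → b ≡ (b +ᶻ x) -ᶻ x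
    eq = solve-∀

  ≈-+-cancelˡ : ∀ b {x y} → b +ᶻ x ≈ b +ᶻ y → x ≈ y
  ≈-+-cancelˡ b {x} {y} p =
    ≈-+-cancelʳ b (≈-trans (≈-reflexive (ℤ.+-comm x b)) (≈-trans p (≈-reflexive (ℤ.+-comm b y))))

  ≈-small : ∀ {a b} → a ≈ b → ∣ a -ᶻ b ∣ < v → a ≡ b
  ≈-small {a} {b} (congruent p) small with ∣ a -ᶻ b ∣ in eq | ∣⇒∣ᵤ p
  ... | zero  | _ = ℤ.i-j≡0⇒i≡j a b (ℤ.∣i∣≡0⇒i≡0 eq)
  ... | suc _ | d = contradiction d (ℕ.>⇒∤ small)

  toℕ-⟦⟧ : ∀ z → + toℕ ⟦ z ⟧ ≈ z
  toℕ-⟦⟧ z = ≈-sym (congruent (divides (z /ℕ v) (begin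
    z -ᶻ + toℕ ⟦ z ⟧                               ≡⟨ cong (λ r → z -ᶻ + r) (toℕ-fromℕ< _) ⟩
    z -ᶻ + (z %ℕ v)                                ≡⟨ cong (_-ᶻ + (z %ℕ v)) (a≡a%ℕn+[a/ℕn]*n z v) ⟩
    (+ (z %ℕ v) +ᶻ (z /ℕ v) *ᶻ + v) -ᶻ + (z %ℕ v)  ≡⟨ eq (+ (z %ℕ v)) _ ⟩
    (z /ℕ v) *ᶻ + v                                ∎)))
    where
    open ≡-Reasoning
    eq : ∀ a b → (a +ᶻ b) -ᶻ a ≡ b
    eq = solve-∀

  ⟦⟧≡⇒≈ : ∀ a b → ⟦ a ⟧ ≡ ⟦ b ⟧ → a ≈ b
  ⟦⟧≡⇒≈ a b eq = ≈-trans (≈-sym (toℕ-⟦⟧ a)) (≈-trans (≈-reflexive (cong (+_ ∘ toℕ) eq)) (toℕ-⟦⟧ b))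

  ∣toℕ-toℕ∣<v : (x y : Fin v) → ∣ + toℕ x -ᶻ + toℕ y ∣ < v
  ∣toℕ-toℕ∣<v x y = ℕ.≤-<-trans
    (subst (λ d → ∣ d ∣ ≤ toℕ x ⊔ toℕ y) (sym (ℤ.[+m]-[+n]≡m⊖n (toℕ x) (toℕ y))) (ℤ.∣m⊝n∣≤m⊔n (toℕ x) (toℕ y)))
    (ℕ.⊔-lub (toℕ<n x) (toℕ<n y))

  toℕ-≈-injective : ∀ {x y : Fin v} → + toℕ x ≈ + toℕ y → x ≡ y
  toℕ-≈-injective {x} {y} p = toℕ-injective (ℤ.+-injective (≈-small p (∣toℕ-toℕ∣<v x y)))

  ≈⇒⟦⟧≡ : ∀ {a b} → a ≈ b → ⟦ a ⟧ ≡ ⟦ b ⟧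
  ≈⇒⟦⟧≡ {a} {b} p = toℕ-≈-injective (≈-trans (toℕ-⟦⟧ a) (≈-trans p (≈-sym (toℕ-⟦⟧ b))))

  ⟦toℕ⟧ : ∀ x → ⟦ + toℕ x ⟧ ≡ x
  ⟦toℕ⟧ x = toℕ-≈-injective (toℕ-⟦⟧ _)

  ⟦⟧-+ₘ : ∀ z a → ⟦ z ⟧ +ₘ a ≡ ⟦ z +ᶻ + a ⟧
  ⟦⟧-+ₘ z a = ≈⇒⟦⟧≡ {+ (toℕ ⟦ z ⟧ + a)} (≈-add (toℕ-⟦⟧ z) (≈-reflexive refl))

-- Starters and their reflections

Spread : ∀ {k} → ℕ → (Fin k → ℤ) → Set
Spread b f = ∀ p q → p ≡ q ⊎ (f p ≢ f q × ∣ f p -ᶻ f q ∣ ≤ b)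

steps mids : ∀ {k} → (Fin k → ℤ) → Fin k → ℤ
steps f p = f (p +ₘ 1) -ᶻ f p
mids  f p = f (p +ₘ 1) +ᶻ f p

record Starter (n k : ℕ) : Set where
  field
    base        : Fin n → Fin k → ℤ
    covers      : ∀ d → 1 ≤ d → d ≤ n * k → ∃₂ λ i p → ∣ steps (base i) p ∣ ≡ d
    -- The bound lies below both orders, so distinctness survives reduction modulo either.
    base-spread : ∀ i → Spread (2 * (n * k)) (base i)
    mids-spread : ∀ i → Spread (2 * (n * k)) (mids (base i))

  diff mid : Fin n → Fin k → ℤ
  diff i = steps (base i)
  mid  i = mids (base i)

∣i∣≡∣j∣⇒i≡±j : ∀ {i j} → ∣ i ∣ ≡ ∣ j ∣ → i ≡ j ⊎ i ≡ - j
∣i∣≡∣j∣⇒i≡±j {+ _} {+ _} refl = inj₁ refl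
∣i∣≡∣j∣⇒i≡±j {+ _} { -[1+ _ ]} refl = inj₂ refl
∣i∣≡∣j∣⇒i≡±j { -[1+ _ ]} {+ suc _} refl = inj₂ refl
∣i∣≡∣j∣⇒i≡±j { -[1+ _ ]} { -[1+ _ ]} refl = inj₁ refl

neg-diff : ∀ a b → (- a) -ᶻ (- b) ≡ - (a -ᶻ b)
neg-diff = solve-∀

∣neg-diff∣ : ∀ a b → ∣ (- a) -ᶻ (- b) ∣ ≡ ∣ a -ᶻ b ∣
∣neg-diff∣ a b = trans (cong ∣_∣ (neg-diff a b)) (ℤ.∣-i∣≡∣i∣ (a -ᶻ b))

neg-spread : ∀ {k b} {f : Fin k → ℤ} → Spread b f → Spread b (-_ ∘ f)
neg-spread {b = b} {f} spread p q =
  map₂ (λ (≢ , small) → ≢ ∘ ℤ.neg-injective , subst (_≤ b) (sym (∣neg-diff∣ (f p) (f q))) small) (spread p q)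

reflect : ∀ {n k} → Starter n k → Starter n k
reflect S = record
  { base        = λ i p → - base i p
  ; covers      = λ d 1≤d d≤N → let i , p , eq = covers d 1≤d d≤N
                                in i , p , trans (∣neg-diff∣ (base i (p +ₘ 1)) (base i p)) eq
  ; base-spread = λ i → neg-spread (base-spread i)
  ; mids-spread = λ i p q → subst-spread i p q (neg-spread (mids-spread i) p q)
  }
  where
  open Starter S
  subst-spread : ∀ i p q → p ≡ q ⊎ (- mid i p ≢ - mid i q × ∣ (- mid i p) -ᶻ (- mid i q) ∣ ≤ _) → _
  subst-spread i p q rewrite ℤ.neg-distrib-+ (base i (p +ₘ 1)) (base i p)
                           | ℤ.neg-distrib-+ (base i (q +ₘ 1)) (base i q) = λ h → h

module _ {A : Set} {N : ℕ} (f : Fin N → A) where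

  index : Fin (length (tabulate f)) → Fin N
  index = cast (length-tabulate f)

  place : Fin N → Fin (length (tabulate f))
  place = cast (sym (length-tabulate f))

  place-index : ∀ j → place (index j) ≡ j
  place-index = cast-involutive (sym (length-tabulate f)) (length-tabulate f)

  lookup-place : ∀ z → lookup (tabulate f) (place z) ≡ f z
  lookup-place = lookup-tabulate f

  lookup-index : ∀ j → lookup (tabulate f) j ≡ f (index j)
  lookup-index j = trans (cong (lookup (tabulate f)) (sym (place-index j))) (lookup-place (index j))

-- Edges of circulant graphs

module _ {w : ℕ} where
  open Residues w

  Lifted : ℕ → Fin v → Fin v → Set
  Lifted N x y = ∃₂ λ s t → ⟦ s ⟧ ≡ x × ⟦ t ⟧ ≡ y × 1 ≤ ∣ t -ᶻ s ∣ × ∣ t -ᶻ s ∣ ≤ N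

  -- The circulant graph with connection set ±1, ..., ±N, phrased through integer representatives so
  -- that its edges can be matched directly with steps of base cycles.
  record IsCirculant (N : ℕ) (Γ : Graph v) : Set where
    field
      adjacent : ∀ s t → 1 ≤ ∣ t -ᶻ s ∣ → ∣ t -ᶻ s ∣ ≤ N → Γ ⟦ s ⟧ ⟦ t ⟧
      lift     : ∀ {x y} → Γ x y → Lifted N x y

  Joins : ℤ → ℤ → Fin v → Fin v → Set
  Joins s t x y = (⟦ s ⟧ ≡ x × ⟦ t ⟧ ≡ y) ⊎ (⟦ s ⟧ ≡ y × ⟦ t ⟧ ≡ x)

  module _ (N : ℕ) (2N<v : 2 * N < v) where

    ≈-short : ∀ {a b} → a ≈ b → ∣ a ∣ ≤ N → ∣ b ∣ ≤ N → a ≡ b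
    ≈-short {a} {b} p a≤N b≤N = ≈-small p (ℕ.≤-<-trans (ℤ.∣i-j∣≤∣i∣+∣j∣ a b)
      (ℕ.≤-<-trans (ℕ.+-mono-≤ a≤N b≤N) (subst (_< v) (cong (λ m → N + m) (ℕ.+-identityʳ N)) 2N<v)))

    -- As `2 * N < v`, a difference of absolute value at most `N` is determined by its residue, so a
    -- common edge yields an equality of differences in ℤ. The two outcomes are the two relative
    -- orientations.
    joins-match : ∀ s t s′ t′ {x y} → Joins s t x y → Joins s′ t′ x y →
      ∣ t -ᶻ s ∣ ≤ N → ∣ t′ -ᶻ s′ ∣ ≤ N →
      (s ≈ s′ × t -ᶻ s ≡ t′ -ᶻ s′) ⊎ (s ≈ t′ × t -ᶻ s ≡ s′ -ᶻ t′)
    joins-match s t s′ t′ e e′ short short′ = go e e′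
      where
      parallel : ⟦ s ⟧ ≡ ⟦ s′ ⟧ → ⟦ t ⟧ ≡ ⟦ t′ ⟧ → s ≈ s′ × t -ᶻ s ≡ t′ -ᶻ s′
      parallel p q = ⟦⟧≡⇒≈ s s′ p , ≈-short (≈-sub (⟦⟧≡⇒≈ t t′ q) (⟦⟧≡⇒≈ s s′ p)) short short′

      antiparallel : ⟦ s ⟧ ≡ ⟦ t′ ⟧ → ⟦ t ⟧ ≡ ⟦ s′ ⟧ → s ≈ t′ × t -ᶻ s ≡ s′ -ᶻ t′
      antiparallel p q = ⟦⟧≡⇒≈ s t′ p , ≈-short (≈-sub (⟦⟧≡⇒≈ t s′ q) (⟦⟧≡⇒≈ s t′ p)) short
        (subst (_≤ N) (ℤ.∣i-j∣≡∣j-i∣ t′ s′) short′)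

      go : ∀ {x y} → Joins s t x y → Joins s′ t′ x y → _
      go (inj₁ (sx , ty)) (inj₁ (s′x , t′y)) = inj₁ (parallel (trans sx (sym s′x)) (trans ty (sym t′y)))
      go (inj₁ (sx , ty)) (inj₂ (s′y , t′x)) = inj₂ (antiparallel (trans sx (sym t′x)) (trans ty (sym s′y)))
      go (inj₂ (sy , tx)) (inj₁ (s′x , t′y)) = inj₂ (antiparallel (trans sy (sym t′y)) (trans tx (sym s′x)))
      go (inj₂ (sy , tx)) (inj₂ (s′y , t′x)) = inj₁ (parallel (trans sy (sym s′y)) (trans tx (sym t′x)))

    spread-injective : ∀ {k} {f : Fin k → ℤ} → Spread (2 * N) f → ∀ {p q} → f p ≈ f q → p ≡ q
    spread-injective spread {p} {q} eq with spread p q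
    ... | inj₁ p≡q         = p≡q
    ... | inj₂ (≢ , small) = contradiction (≈-small eq (ℕ.≤-<-trans small 2N<v)) ≢

-- Development of a starter into a cyclic decomposition

module Development {n k′ w : ℕ} (2N<v : 2 * (n * suc k′) < suc w) (S : Starter n (suc k′)) where
  open Residues w
  open Starter S

  k : ℕ
  k = suc k′

  private
    bijective = onto-range⇒bijective (λ z → let i , p = remQuot {n} k z in ∣ diff i p ∣) λ d 1≤d d≤N →
      let i , p , eq = covers d 1≤d d≤N
      in combine i p , trans (cong (λ (i , p) → ∣ diff i p ∣) (remQuot-combine i p)) eq

  diff-range : ∀ i p → 1 ≤ ∣ diff i p ∣ × ∣ diff i p ∣ ≤ n * k
  diff-range i p = subst (λ (i , p) → 1 ≤ ∣ diff i p ∣ × ∣ diff i p ∣ ≤ n * k)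
    (remQuot-combine i p) (proj₁ bijective (combine i p))

  ∣diff∣-injective : ∀ {i p j q} → ∣ diff i p ∣ ≡ ∣ diff j q ∣ → (i , p) ≡ (j , q)
  ∣diff∣-injective {i} {p} {j} {q} eq = begin
    i , p                        ≡⟨ remQuot-combine i p ⟨
    remQuot {n} k (combine i p)  ≡⟨ cong (remQuot {n} k) (proj₂ bijective combined) ⟩
    remQuot {n} k (combine j q)  ≡⟨ remQuot-combine j q ⟩
    j , q                        ∎
    where
    open ≡-Reasoning
    combined : _
    combined = trans (cong (λ (i , p) → ∣ diff i p ∣) (remQuot-combine i p))
      (trans eq (cong (λ (i , p) → ∣ diff i p ∣) (sym (remQuot-combine j q))))

  -- Equal absolute values force the same position, and a difference equal to its own negative would
  -- be 0. This rules out one orientation of a common edge: the opposite one inside 𝒞, the parallel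
  -- one between 𝒞 and 𝒞′.
  diff≢-diff : ∀ {i p j q} → diff i p ≢ - diff j q
  diff≢-diff {i} {p} {j} {q} eq
    with refl ← ∣diff∣-injective {i} {p} {j} {q} (trans (cong ∣_∣ eq) (ℤ.∣-i∣≡∣i∣ (diff j q)))
    = nonzero (proj₁ (diff-range i p)) eq
    where
    nonzero : ∀ {z} → 1 ≤ ∣ z ∣ → z ≢ - z
    nonzero {+ suc _}    _ ()
    nonzero { -[1+ _ ] } _ ()

  vertex : Fin n → Fin v → Fin k → ℤ
  vertex i a p = base i p +ᶻ + toℕ a

  walk : Fin n → Fin v → Walk v k
  walk i a p = ⟦ vertex i a p ⟧

  vertex-diff : ∀ i a p → vertex i a (p +ₘ 1) -ᶻ vertex i a p ≡ diff i p
  vertex-diff i a p = eq (base i (p +ₘ 1)) (base i p) (+ toℕ a)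
    where
    eq : ∀ x y z → (x +ᶻ z) -ᶻ (y +ᶻ z) ≡ x -ᶻ y
    eq = solve-∀

  vertex-short : ∀ i a p → ∣ vertex i a (p +ₘ 1) -ᶻ vertex i a p ∣ ≤ n * k
  vertex-short i a p = subst (λ d → ∣ d ∣ ≤ n * k) (sym (vertex-diff i a p)) (proj₂ (diff-range i p))

  -- The difference of an edge determines the base cycle and the position in it; the end of the edge
  -- then determines the translate.
  same-edge⇒same-code : ∀ {i a j b x y} → EdgeIn (walk i a) x y → EdgeIn (walk j b) x y → (i , a) ≡ (j , b)
  same-edge⇒same-code {i} {a} {j} {b} (p , e) (q , f) = by-orientation
    (joins-match (n * k) 2N<v s t s′ t′ e f (vertex-short i a p) (vertex-short j b q))
    where
    s t s′ t′ : ℤ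
    s  = vertex i a p
    t  = vertex i a (p +ₘ 1)
    s′ = vertex j b q
    t′ = vertex j b (q +ₘ 1)

    swapped : ∀ x y → x -ᶻ y ≡ - (y -ᶻ x)
    swapped = solve-∀

    diff≡diff : t -ᶻ s ≡ t′ -ᶻ s′ → diff i p ≡ diff j q
    diff≡diff eq = trans (sym (vertex-diff i a p)) (trans eq (vertex-diff j b q))

    diff≡-diff : t -ᶻ s ≡ s′ -ᶻ t′ → diff i p ≡ - diff j q
    diff≡-diff eq = trans (sym (vertex-diff i a p))
      (trans eq (trans (swapped s′ t′) (cong -_ (vertex-diff j b q))))

    aligned : s ≈ s′ → (i , p) ≡ (j , q) → (i , a) ≡ (j , b)
    aligned s≈s′ refl = cong (i ,_) (toℕ-≈-injective (≈-+-cancelˡ (base i p) s≈s′))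

    by-orientation : (s ≈ s′ × t -ᶻ s ≡ t′ -ᶻ s′) ⊎ (s ≈ t′ × t -ᶻ s ≡ s′ -ᶻ t′) → (i , a) ≡ (j , b)
    by-orientation (inj₁ (s≈s′ , eq)) = aligned s≈s′ (∣diff∣-injective (cong ∣_∣ (diff≡diff eq)))
    by-orientation (inj₂ (_ , eq))    = contradiction (diff≡-diff eq) diff≢-diff

  cycleAt : Fin (n * v) → Walk v k
  cycleAt z = uncurry walk (remQuot {n} v z)

  cycles : List (Walk v k)
  cycles = tabulate cycleAt

  code : Fin (length cycles) → Fin n × Fin v
  code j = remQuot {n} v (index cycleAt j)

  position : Fin n × Fin v → Fin (length cycles)
  position (i , a) = place cycleAt (combine i a)

  lookup-code : ∀ j → lookup cycles j ≡ uncurry walk (code j)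
  lookup-code = lookup-index cycleAt

  lookup-position : ∀ c → lookup cycles (position c) ≡ uncurry walk c
  lookup-position (i , a) =
    trans (lookup-place cycleAt (combine i a)) (cong (uncurry walk) (remQuot-combine i a))

  position-code : ∀ j → position (code j) ≡ j
  position-code j =
    trans (cong (place cycleAt) (combine-remQuot {n} v (index cycleAt j))) (place-index cycleAt j)

  walk-injective : ∀ i a → IsCycle (walk i a)
  walk-injective i a {p} {q} eq = spread-injective (n * k) 2N<v (base-spread i)
    (≈-+-cancelʳ (+ toℕ a) (⟦⟧≡⇒≈ (vertex i a p) (vertex i a q) eq))

  cyclic : IsCyclic cycles
  cyclic j = position (i , a +ₘ 1) , zero , inj₁ λ p → begin
    translate (lookup cycles j) p
      ≡⟨ cong (λ c → translate c p) (lookup-code j) ⟩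
    ⟦ vertex i a p ⟧ +ₘ 1
      ≡⟨ ⟦⟧-+ₘ (vertex i a p) 1 ⟩
    ⟦ (base i p +ᶻ + toℕ a) +ᶻ + 1 ⟧
      ≡⟨ cong ⟦_⟧ (ℤ.+-assoc (base i p) (+ toℕ a) (+ 1)) ⟩
    ⟦ base i p +ᶻ + (toℕ a + 1) ⟧
      ≡⟨ ≈⇒⟦⟧≡ (≈-add (≈-reflexive {base i p} refl) (≈-sym (toℕ-⟦⟧ (+ (toℕ a + 1))))) ⟩
    walk i (a +ₘ 1) p
      ≡⟨ cong (walk i (a +ₘ 1)) (sym (+ₘ-identityʳ p)) ⟩
    walk i (a +ₘ 1) (p +ₘ 0)
      ≡⟨ cong (λ c → c (p +ₘ 0)) (lookup-position (i , a +ₘ 1)) ⟨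
    lookup cycles (position (i , a +ₘ 1)) (p +ₘ 0)
      ∎
    where
    open ≡-Reasoning
    i = proj₁ (code j)
    a = proj₂ (code j)
    +ₘ-identityʳ : ∀ (p : Fin k) → p +ₘ 0 ≡ p
    +ₘ-identityʳ p = trans (cong (_+ₘ 0) (sym (ℤₖ.⟦toℕ⟧ p))) (trans (ℤₖ.⟦⟧-+ₘ (+ toℕ p) 0)
      (trans (cong ℤₖ.⟦_⟧ (ℤ.+-identityʳ (+ toℕ p))) (ℤₖ.⟦toℕ⟧ p)))
      where module ℤₖ = Residues k′

  walk-through : ∀ s i p → ∃[ a ] (walk i a p ≡ ⟦ s ⟧ × walk i a (p +ₘ 1) ≡ ⟦ s +ᶻ diff i p ⟧)
  walk-through s i p = a ,
    ≈⇒⟦⟧≡ (≈-trans (near (base i p)) (≈-reflexive (eq₁ (base i p) s))) ,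
    ≈⇒⟦⟧≡ (≈-trans (near (base i (p +ₘ 1))) (≈-reflexive (eq₂ (base i (p +ₘ 1)) (base i p) s)))
    where
    a : Fin v
    a = ⟦ s -ᶻ base i p ⟧
    near : ∀ b → b +ᶻ + toℕ a ≈ b +ᶻ (s -ᶻ base i p)
    near b = ≈-add (≈-reflexive {b} refl) (toℕ-⟦⟧ (s -ᶻ base i p))
    eq₁ : ∀ b s → b +ᶻ (s -ᶻ b) ≡ s
    eq₁ = solve-∀
    eq₂ : ∀ c b s → c +ᶻ (s -ᶻ b) ≡ s +ᶻ (c -ᶻ b)
    eq₂ = solve-∀

  module _ {Γ : Graph v} (circulant : IsCirculant (n * k) Γ) where
    open IsCirculant circulant

    edge-adjacent : ∀ i a {x y} → EdgeIn (walk i a) x y → Γ x y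
    edge-adjacent i a (p , inj₁ (refl , refl)) = adjacent (vertex i a p) (vertex i a (p +ₘ 1))
      (subst (λ d → 1 ≤ ∣ d ∣) (sym (vertex-diff i a p)) (proj₁ (diff-range i p))) (vertex-short i a p)
    edge-adjacent i a (p , inj₂ (refl , refl)) = adjacent (vertex i a (p +ₘ 1)) (vertex i a p)
      (subst (1 ≤_) flip (subst (λ d → 1 ≤ ∣ d ∣) (sym (vertex-diff i a p)) (proj₁ (diff-range i p))))
      (subst (_≤ n * k) flip (vertex-short i a p))
      where
      flip = ℤ.∣i-j∣≡∣j-i∣ (vertex i a (p +ₘ 1)) (vertex i a p)

    -- `covers` fixes the difference only up to sign; the sign decides whether the translate is laid
    -- from `s` to `t` or from `t` to `s`.
    edge-covered : ∀ {x y} → Γ x y → ∃₂ λ i a → EdgeIn (walk i a) x y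
    edge-covered Γxy with lift Γxy
    ... | s , t , refl , refl , 1≤d , d≤N with covers ∣ t -ᶻ s ∣ 1≤d d≤N
    ... | i , p , eq with ∣i∣≡∣j∣⇒i≡±j eq
    ... | inj₁ d≡ = let a , here , there = walk-through s i p in
      i , a , p , inj₁ (here , trans there (cong ⟦_⟧ (trans (cong (s +ᶻ_) d≡) (fwd s t))))
      where
      fwd : ∀ s t → s +ᶻ (t -ᶻ s) ≡ t
      fwd = solve-∀
    ... | inj₂ d≡ = let a , here , there = walk-through t i p in
      i , a , p , inj₂ (here , trans there (cong ⟦_⟧ (trans (cong (t +ᶻ_) d≡) (bwd s t))))
      where
      bwd : ∀ s t → t +ᶻ (- (t -ᶻ s)) ≡ s
      bwd = solve-∀

    decomposition : IsDecomposition k Γ cycles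
    decomposition =
      (λ j → subst (IsCycleOf Γ) (sym (lookup-code j))
        (walk-injective _ _ , λ x y → edge-adjacent _ _)) ,
      λ x y Γxy → let i , a , e = edge-covered Γxy in
        position (i , a) ,
        subst (λ c → EdgeIn c x y) (sym (lookup-position (i , a))) e ,
        λ j e′ → trans (sym (position-code j)) (cong position
          (same-edge⇒same-code (subst (λ c → EdgeIn c x y) (lookup-code j) e′) e))

    cyclicDecomposition : CyclicDecomposition k Γ cycles
    cyclicDecomposition = decomposition , cyclic

-- Orthogonality of the two developments

module _ {n k′ w : ℕ} (2N<v : 2 * (n * suc k′) < suc w) (S : Starter n (suc k′)) where
  open Residues w
  open Starter S
  private
    module C = Development 2N<v S
    module C′ = Development 2N<v (reflect S)

  reflect-diff : ∀ i p → Starter.diff (reflect S) i p ≡ - diff i p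
  reflect-diff i p = neg-diff (base i (p +ₘ 1)) (base i p)

  -- Reflection negates every difference, so the two cycles traverse a common edge in opposite
  -- directions. The right-hand side depends on the two cycles only, not on the edge.
  shared-edge : ∀ {i a j b x y} ((p , _) : EdgeIn (C.walk i a) x y) → EdgeIn (C′.walk j b) x y →
    mid i p ≈ + toℕ b -ᶻ + toℕ a
  shared-edge {i} {a} {j} {b} (p , e) (q , f) = by-orientation
    (joins-match (n * suc k′) 2N<v s t s′ t′ e f (C.vertex-short i a p) (C′.vertex-short j b q))
    where
    s t s′ t′ : ℤ
    s  = C.vertex i a p
    t  = C.vertex i a (p +ₘ 1)
    s′ = C′.vertex j b q
    t′ = C′.vertex j b (q +ₘ 1)

    swapped : ∀ x y b → (- x +ᶻ b) -ᶻ (- y +ᶻ b) ≡ y -ᶻ x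
    swapped = solve-∀
    left : ∀ c′ c a → c′ +ᶻ c ≡ (c +ᶻ a) +ᶻ (c′ -ᶻ a)
    left = solve-∀
    right : ∀ c′ a b → (- c′ +ᶻ b) +ᶻ (c′ -ᶻ a) ≡ b -ᶻ a
    right = solve-∀

    diff≡-diff : t -ᶻ s ≡ t′ -ᶻ s′ → diff i p ≡ - diff j q
    diff≡-diff eq = trans (sym (C.vertex-diff i a p))
      (trans eq (trans (C′.vertex-diff j b q) (reflect-diff j q)))

    diff≡diff : t -ᶻ s ≡ s′ -ᶻ t′ → diff i p ≡ diff j q
    diff≡diff eq = trans (sym (C.vertex-diff i a p))
      (trans eq (swapped (base j q) (base j (q +ₘ 1)) (+ toℕ b)))

    aligned : s ≈ t′ → (i , p) ≡ (j , q) → mid i p ≈ + toℕ b -ᶻ + toℕ a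
    aligned s≈t′ refl = ≈-trans (≈-reflexive (left (base i (p +ₘ 1)) (base i p) (+ toℕ a)))
      (≈-trans (≈-add s≈t′ (≈-reflexive {base i (p +ₘ 1) -ᶻ + toℕ a} refl))
        (≈-reflexive (right (base i (p +ₘ 1)) (+ toℕ a) (+ toℕ b))))

    by-orientation : (s ≈ s′ × t -ᶻ s ≡ t′ -ᶻ s′) ⊎ (s ≈ t′ × t -ᶻ s ≡ s′ -ᶻ t′) →
      mid i p ≈ + toℕ b -ᶻ + toℕ a
    by-orientation (inj₁ (_ , eq))    = contradiction (diff≡-diff eq) C.diff≢-diff
    by-orientation (inj₂ (s≈t′ , eq)) = aligned s≈t′ (C.∣diff∣-injective (cong ∣_∣ (diff≡diff eq)))

  orthogonal : Orthogonal C.cycles C′.cycles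
  orthogonal j j′ x y x′ y′ e f e′ f′
    rewrite C.lookup-code j | C′.lookup-code j′
    = same-position e e′ (spread-injective (n * suc k′) 2N<v (mids-spread _)
        (≈-trans (shared-edge e f) (≈-sym (shared-edge e′ f′))))
    where
    same-position : ∀ {c : Walk v (suc k′)} {x y x′ y′} (e : EdgeIn c x y) (e′ : EdgeIn c x′ y′) →
      proj₁ e ≡ proj₁ e′ → SameEdge x y x′ y′
    same-position (p , inj₁ (refl , refl)) (p , inj₁ (refl , refl)) refl = inj₁ (refl , refl)
    same-position (p , inj₁ (refl , refl)) (p , inj₂ (refl , refl)) refl = inj₂ (refl , refl)
    same-position (p , inj₂ (refl , refl)) (p , inj₁ (refl , refl)) refl = inj₂ (refl , refl)
    same-position (p , inj₂ (refl , refl)) (p , inj₂ (refl , refl)) refl = inj₁ (refl , refl)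

  orthogonalPair : {Γ : Graph v} → IsCirculant (n * suc k′) Γ → HasOrthogonalCyclicPair (suc k′) Γ
  orthogonalPair circulant = C.cycles , C′.cycles ,
    C.cyclicDecomposition circulant , C′.cyclicDecomposition circulant , orthogonal

-- The two graphs as circulant graphs

module _ {w : ℕ} where
  open Residues w

  not-congruent : ∀ s t → 1 ≤ ∣ t -ᶻ s ∣ → ∣ t -ᶻ s ∣ < v → ⟦ s ⟧ ≢ ⟦ t ⟧
  not-congruent s t 1≤d d<v eq = ℕ.<⇒≢ 1≤d (sym (cong ∣_∣ (ℤ.i≡j⇒i-j≡0 (sym s≡t))))
    where
    s≡t : s ≡ t
    s≡t = ≈-small (⟦⟧≡⇒≈ s t eq) (subst (_< v) (ℤ.∣i-j∣≡∣j-i∣ t s) d<v)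

  -- Going round the other way: this representative is short when `z` is long.
  wrap : ∀ z → ∣ z ∣ < v → ∃[ z′ ] (z′ ≈ z × ∣ z′ ∣ ≡ v ∸ ∣ z ∣)
  wrap (+ e) e<v = + e -ᶻ + v , congruent (subst (+ v ∣_) (eq (+ e) (+ v)) (∣m⇒∣-m ∣-refl)) ,
    trans (cong ∣_∣ (ℤ.[+m]-[+n]≡m⊖n e v)) (ℤ.∣⊖∣-≤ (ℕ.<⇒≤ e<v))
    where
    eq : ∀ e v → - v ≡ (e -ᶻ v) -ᶻ e
    eq = solve-∀
  wrap -[1+ e ] e<v = + v -ᶻ + suc e , congruent (subst (+ v ∣_) (eq (+ v) (+ suc e)) ∣-refl) ,
    cong ∣_∣ (trans (ℤ.[+m]-[+n]≡m⊖n v (suc e)) (ℤ.⊖-≥ (ℕ.<⇒≤ e<v)))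
    where
    eq : ∀ v e → v ≡ (v -ᶻ e) -ᶻ (- e)
    eq = solve-∀

  lift-difference : ∀ {N} {x y : Fin v} z → z ≈ + toℕ y -ᶻ + toℕ x → 1 ≤ ∣ z ∣ → ∣ z ∣ ≤ N → Lifted N x y
  lift-difference {N} {x} {y} z z≈ 1≤z z≤N =
    + toℕ x , + toℕ x +ᶻ z , ⟦toℕ⟧ x ,
    trans (≈⇒⟦⟧≡ (≈-trans (≈-add (≈-reflexive {+ toℕ x} refl) z≈)
      (≈-reflexive (eq (+ toℕ x) (+ toℕ y))))) (⟦toℕ⟧ y) ,
    subst (λ d → 1 ≤ ∣ d ∣) (sym (eq′ (+ toℕ x) z)) 1≤z ,
    subst (λ d → ∣ d ∣ ≤ N) (sym (eq′ (+ toℕ x) z)) z≤N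
    where
    eq : ∀ x y → x +ᶻ (y -ᶻ x) ≡ y
    eq = solve-∀
    eq′ : ∀ x z → (x +ᶻ z) -ᶻ x ≡ z
    eq′ = solve-∀

  distance : Fin v → Fin v → ℕ
  distance x y = ∣ + toℕ y -ᶻ + toℕ x ∣

  lift-near : ∀ {N x y} → x ≢ y → distance x y ≤ N → Lifted N x y
  lift-near {N} {x} {y} x≢y near = lift-difference (+ toℕ y -ᶻ + toℕ x) (≈-reflexive refl)
    (ℕ.n≢0⇒n>0 λ d≡0 → x≢y (sym (toℕ-injective
      (ℤ.+-injective (ℤ.i-j≡0⇒i≡j (+ toℕ y) (+ toℕ x) (ℤ.∣i∣≡0⇒i≡0 d≡0)))))) near

  lift-far : ∀ {N x y} → v ∸ distance x y ≤ N → Lifted N x y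
  lift-far {N} {x} {y} far with wrap (+ toℕ y -ᶻ + toℕ x) (∣toℕ-toℕ∣<v y x)
  ... | z , z≈ , eq = lift-difference z z≈
    (subst (1 ≤_) (sym eq) (ℕ.m<n⇒0<n∸m (∣toℕ-toℕ∣<v y x))) (subst (_≤ N) (sym eq) far)

-- `d` and `2N + 1 − d` are the same difference up to sign, and one of them is at most `N`.
complete-circulant : ∀ N → IsCirculant N (Complete (suc (2 * N)))
complete-circulant N = record
  { adjacent = λ s t 1≤d d≤N → not-congruent s t 1≤d (s≤s (ℕ.≤-trans d≤N (ℕ.m≤m+n N _)))
  ; lift     = λ {x} {y} x≢y → near-or-far x≢y (distance x y ℕ.≤? N)
  }
  where
  open Residues (2 * N)
  near-or-far : ∀ {x y} → x ≢ y → Dec (distance x y ≤ N) → Lifted N x y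
  near-or-far x≢y (yes near) = lift-near x≢y near
  near-or-far {x} {y} x≢y (no ¬near) = lift-far {x = x} {y} (begin
    suc (2 * N) ∸ distance x y  ≤⟨ ℕ.∸-monoʳ-≤ (suc (2 * N)) (ℕ.≰⇒> ¬near) ⟩
    2 * N ∸ N                   ≡⟨ ℕ.m+n∸m≡n N (1 * N) ⟩
    1 * N                       ≡⟨ ℕ.*-identityˡ N ⟩
    N                           ∎)
    where open ℕ.≤-Reasoning

-- One of `d` and `2N + 2 − d` is at most `N` unless both are `N + 1`, the difference of the removed
-- 1-factor.
cocktailParty-circulant : ∀ N → IsCirculant N (CocktailParty (suc N))
cocktailParty-circulant N = record
  { adjacent = λ s t 1≤d d≤N →
      not-congruent s t 1≤d (s≤s (ℕ.≤-trans d≤N (ℕ.m≤m+n N _))) , not-antipodal s t d≤N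
  ; lift     = λ {x} {y} (x≢y , y≢x+t) → near-or-far x≢y y≢x+t (ℕ.<-cmp (distance x y) (suc N))
  }
  where
  -- `2 * suc N` computes to `suc (N + 1 * suc N)`, so this is the modulus on the nose.
  open Residues (N + 1 * suc N)

  not-antipodal : ∀ s t → ∣ t -ᶻ s ∣ ≤ N → ⟦ t ⟧ ≢ ⟦ s ⟧ +ₘ suc N
  not-antipodal s t d≤N eq = ℕ.<-irrefl refl (subst (λ d → ∣ d ∣ ≤ N) (≈-small d≈t small) d≤N)
    where
    cancel : ∀ s t → (s +ᶻ t) -ᶻ s ≡ t
    cancel = solve-∀
    d≈t : t -ᶻ s ≈ + suc N
    d≈t = ≈-trans (≈-sub (⟦⟧≡⇒≈ t (s +ᶻ + suc N) (trans eq (⟦⟧-+ₘ s (suc N)))) (≈-reflexive {s} refl))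
      (≈-reflexive (cancel s (+ suc N)))
    -- At most `N + (N + 1)`, one less than the modulus.
    small : ∣ (t -ᶻ s) -ᶻ + suc N ∣ < v
    small = ℕ.≤-<-trans (ℤ.∣i-j∣≤∣i∣+∣j∣ (t -ᶻ s) (+ suc N))
      (s≤s (ℕ.+-mono-≤ d≤N (ℕ.≤-reflexive (sym (ℕ.*-identityˡ (suc N))))))

  antipodal : ∀ x y z → z ≡ + toℕ y -ᶻ + toℕ x → ∣ z ∣ ≡ suc N → y ≡ x +ₘ suc N
  antipodal x y z z≡ ∣z∣≡ = begin
    y                                        ≡⟨ ⟦toℕ⟧ y ⟨
    ⟦ + toℕ y ⟧                              ≡⟨ cong ⟦_⟧ (back (+ toℕ x) (+ toℕ y)) ⟩
    ⟦ + toℕ x +ᶻ (+ toℕ y -ᶻ + toℕ x) ⟧      ≡⟨ cong (λ d → ⟦ + toℕ x +ᶻ d ⟧) z≡ ⟨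
    ⟦ + toℕ x +ᶻ z ⟧                         ≡⟨ ≈⇒⟦⟧≡ (≈-add (≈-reflexive {+ toℕ x} refl) (half-turn z ∣z∣≡)) ⟩
    ⟦ + toℕ x +ᶻ + suc N ⟧                   ≡⟨ ⟦⟧-+ₘ (+ toℕ x) (suc N) ⟨
    ⟦ + toℕ x ⟧ +ₘ suc N                     ≡⟨ cong (_+ₘ suc N) (⟦toℕ⟧ x) ⟩
    x +ₘ suc N                               ∎
    where
    open ≡-Reasoning
    back : ∀ x y → y ≡ x +ᶻ (y -ᶻ x)
    back = solve-∀
    double : ∀ t → - (t +ᶻ t) ≡ (- t) -ᶻ t
    double = solve-∀
    half-turn : ∀ z → ∣ z ∣ ≡ suc N → z ≈ + suc N
    half-turn (+ _)    refl = ≈-reflexive refl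
    -- `−(N + 1)` and `N + 1` differ by the modulus `2N + 2`.
    half-turn -[1+ _ ] refl = congruent (subst (+ v ∣_)
      (trans (cong (λ h → - (+ suc N +ᶻ + h)) (ℕ.*-identityˡ (suc N))) (double (+ suc N))) (∣m⇒∣-m ∣-refl))

  near-or-far : ∀ {x y} → x ≢ y → y ≢ x +ₘ suc N →
    Tri (distance x y < suc N) (distance x y ≡ suc N) (suc N < distance x y) → Lifted N x y
  near-or-far x≢y _ (tri< near _ _) = lift-near x≢y (ℕ.≤-pred near)
  near-or-far {x} {y} _ y≢x+t (tri≈ _ eq _) = contradiction (antipodal x y _ refl eq) y≢x+t
  near-or-far {x} {y} _ _ (tri> _ _ far) = lift-far {x = x} {y} (begin
    suc (N + 1 * suc N) ∸ distance x y  ≤⟨ ℕ.∸-monoʳ-≤ (suc (N + 1 * suc N)) far ⟩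
    N + 1 * suc N ∸ suc N               ≡⟨ cong (λ h → N + h ∸ suc N) (ℕ.*-identityˡ (suc N)) ⟩
    N + suc N ∸ suc N                   ≡⟨ ℕ.m+n∸n≡m N (suc N) ⟩
    N                                   ∎)
    where open ℕ.≤-Reasoning

orthogonal-pairs : ∀ n k′ → Starter n (suc k′) →
  HasOrthogonalCyclicPair (suc k′) (Complete (2 * n * suc k′ + 1))
    × HasOrthogonalCyclicPair (suc k′) (CocktailParty (n * suc k′ + 1))
orthogonal-pairs n k′ S =
  subst (λ v → HasOrthogonalCyclicPair (suc k′) (Complete v)) order
    (orthogonalPair ℕ.≤-refl S (complete-circulant N)) ,
  subst (λ t → HasOrthogonalCyclicPair (suc k′) (CocktailParty t)) (ℕ.+-comm 1 N)
    (orthogonalPair (s≤s (ℕ.+-monoʳ-≤ N (ℕ.*-monoʳ-≤ 1 (ℕ.n≤1+n N)))) S (cocktailParty-circulant N))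
  where
  N = n * suc k′
  order : suc (2 * N) ≡ 2 * n * suc k′ + 1
  order = trans (ℕ.+-comm 1 (2 * N)) (cong (_+ 1) (sym (ℕ.*-assoc 2 n (suc k′))))

-- Linear forms and their coefficientwise order

-- The triple (a , b , c) stands for the linear form a + b r + c r′.
Form : Set
Form = ℕ × ℕ × ℕ

⟨_⟩ : Form → ℕ → ℕ → ℕ
⟨ a , b , c ⟩ r r′ = a + b * r + c * r′

infixl 6 _⊕_
_⊕_ : Form → Form → Form
(a , b , c) ⊕ (a′ , b′ , c′) = a + a′ , b + b′ , c + c′

infix 4 _≤ᶠ_ _≤ᶠ?_ _≟ᶠ_
-- Sufficient, though not necessary, for the inequality at all natural `r` and `r′`; in exchange it
-- is decided once for all of them. The rows below are such that vertices, and likewise sums, are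
-- pairwise comparable in this sense.
_≤ᶠ_ : Form → Form → Set
(a , b , c) ≤ᶠ (a′ , b′ , c′) = a ≤ a′ × b ≤ b′ × c ≤ c′

_≤ᶠ?_ : ∀ x y → Dec (x ≤ᶠ y)
(a , b , c) ≤ᶠ? (a′ , b′ , c′) = a ℕ.≤? a′ ×-dec b ℕ.≤? b′ ×-dec c ℕ.≤? c′

_≟ᶠ_ : DecidableEquality Form
_≟ᶠ_ = ≡-dec ℕ._≟_ (≡-dec ℕ._≟_ ℕ._≟_)

⟨⟩-⊕ : ∀ x y r r′ → ⟨ x ⊕ y ⟩ r r′ ≡ ⟨ x ⟩ r r′ + ⟨ y ⟩ r r′
⟨⟩-⊕ (a , b , c) (a′ , b′ , c′) = eq a b c a′ b′ c′
  where
  eq : ∀ a b c a′ b′ c′ r r′ →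
    (a + a′) + (b + b′) * r + (c + c′) * r′ ≡ (a + b * r + c * r′) + (a′ + b′ * r + c′ * r′)
  eq = ℕSolver.solve-∀

⟨⟩-mono-≤ : ∀ {x y} r r′ → x ≤ᶠ y → ⟨ x ⟩ r r′ ≤ ⟨ y ⟩ r r′
⟨⟩-mono-≤ r r′ (a≤ , b≤ , c≤) = ℕ.+-mono-≤ (ℕ.+-mono-≤ a≤ (ℕ.*-monoˡ-≤ r b≤)) (ℕ.*-monoˡ-≤ r′ c≤)

-- Strictness sits in the constant term, since `r` and `r′` may both be 0.
Below : Form → Form → Form → Set
Below b x y = (1 , 0 , 0) ⊕ x ≤ᶠ y × y ≤ᶠ x ⊕ b

SpreadForms : ∀ {k} → Form → (Fin k → Form) → Set
SpreadForms b f = ∀ p q → p ≡ q ⊎ (Below b (f p) (f q) ⊎ Below b (f q) (f p))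

spreadForms? : ∀ {k} b (f : Fin k → Form) → Dec (SpreadForms b f)
spreadForms? b f = all? λ p → all? λ q → (p ≟ q) ⊎-dec (below? (f p) (f q) ⊎-dec below? (f q) (f p))
  where
  below? : ∀ x y → Dec (Below b x y)
  below? x y = ((1 , 0 , 0) ⊕ x ≤ᶠ? y) ×-dec (y ≤ᶠ? x ⊕ b)

below-sound : ∀ {b x y} r r′ → Below b x y →
  ⟨ x ⟩ r r′ < ⟨ y ⟩ r r′ × ⟨ y ⟩ r r′ ≤ ⟨ x ⟩ r r′ + ⟨ b ⟩ r r′
below-sound {b} {x} {y} r r′ (lower , upper) =
  ⟨⟩-mono-≤ {(1 , 0 , 0) ⊕ x} {y} r r′ lower ,
  subst (⟨ y ⟩ r r′ ≤_) (⟨⟩-⊕ x b r r′) (⟨⟩-mono-≤ {y} {x ⊕ b} r r′ upper)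

∣pos-pos∣≤ : ∀ {x y b} → x < y → y ≤ x + b → ∣ + y -ᶻ + x ∣ ≤ b
∣pos-pos∣≤ {x} {y} {b} x<y y≤x+b = begin
  ∣ + y -ᶻ + x ∣  ≡⟨ cong ∣_∣ (trans (ℤ.[+m]-[+n]≡m⊖n y x) (ℤ.⊖-≥ (ℕ.<⇒≤ x<y))) ⟩
  y ∸ x           ≤⟨ ℕ.m≤n+o⇒m∸n≤o y x y≤x+b ⟩
  b               ∎
  where open ℕ.≤-Reasoning

spreadForms-sound : ∀ {k b} {f : Fin k → Form} r r′ →
  SpreadForms b f → Spread (⟨ b ⟩ r r′) (λ p → + ⟨ f p ⟩ r r′)
spreadForms-sound {b = b} {f} r r′ spread p q with spread p q
... | inj₁ p≡q          = inj₁ p≡q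
... | inj₂ (inj₁ below) = let x<y , y≤ = below-sound {b} {f p} {f q} r r′ below in
  inj₂ (ℕ.<⇒≢ x<y ∘ ℤ.+-injective ,
    subst (_≤ ⟨ b ⟩ r r′) (ℤ.∣i-j∣≡∣j-i∣ (+ ⟨ f q ⟩ r r′) (+ ⟨ f p ⟩ r r′)) (∣pos-pos∣≤ x<y y≤))
... | inj₂ (inj₂ above) = let x<y , y≤ = below-sound {b} {f q} {f p} r r′ above in
  inj₂ (ℕ.<⇒≢ x<y ∘ sym ∘ ℤ.+-injective , ∣pos-pos∣≤ x<y y≤)

spread-cong : ∀ {k b} {f g : Fin k → ℤ} → (∀ p → f p ≡ g p) → Spread b f → Spread b g
spread-cong f≗g spread p q rewrite sym (f≗g p) | sym (f≗g q) = spread p q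

-- Cycles whose vertices are linear forms

Row : ℕ → Set
Row k = Vec Form k

midForms : ∀ {k} → Row k → Fin k → Form
midForms R p = Vec.lookup R (p +ₘ 1) ⊕ Vec.lookup R p

realise : ∀ {k} → Row k → ℕ → ℕ → Fin k → ℤ
realise R r r′ p = + ⟨ Vec.lookup R p ⟩ r r′

realise-mids : ∀ {k} (R : Row k) r r′ p → + ⟨ midForms R p ⟩ r r′ ≡ mids (realise R r r′) p
realise-mids R r r′ p = cong +_ (⟨⟩-⊕ (Vec.lookup R (p +ₘ 1)) (Vec.lookup R p) r r′)

-- Forms have no subtraction, so a step of absolute value `x` is an addition of `x` in one of the
-- two directions.
StepIs : ∀ {k} → Row k → Fin k → Form → Set
StepIs R p x =
  Vec.lookup R (p +ₘ 1) ≡ Vec.lookup R p ⊕ x ⊎ Vec.lookup R p ≡ Vec.lookup R (p +ₘ 1) ⊕ x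

stepIs? : ∀ {k} (R : Row k) p x → Dec (StepIs R p x)
stepIs? R p x =
  (Vec.lookup R (p +ₘ 1) ≟ᶠ Vec.lookup R p ⊕ x) ⊎-dec (Vec.lookup R p ≟ᶠ Vec.lookup R (p +ₘ 1) ⊕ x)

∣pos-pos-+∣ : ∀ x y {d} → x ≡ y + d → ∣ + x -ᶻ + y ∣ ≡ d
∣pos-pos-+∣ _ y {d} refl = cong ∣_∣ (trans (ℤ.[+m]-[+n]≡m⊖n (y + d) y)
  (trans (ℤ.⊖-≥ (ℕ.m≤m+n y d)) (cong +_ (ℕ.m+n∸m≡n y d))))

stepIs-sound : ∀ {k} (R : Row k) p x r r′ → StepIs R p x → ∣ steps (realise R r r′) p ∣ ≡ ⟨ x ⟩ r r′
stepIs-sound R p x r r′ (inj₁ eq) =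
  ∣pos-pos-+∣ (⟨ Vec.lookup R (p +ₘ 1) ⟩ r r′) (⟨ Vec.lookup R p ⟩ r r′)
    (trans (cong (λ y → ⟨ y ⟩ r r′) eq) (⟨⟩-⊕ (Vec.lookup R p) x r r′))
stepIs-sound R p x r r′ (inj₂ eq) = trans
  (ℤ.∣i-j∣≡∣j-i∣ (+ ⟨ Vec.lookup R (p +ₘ 1) ⟩ r r′) (+ ⟨ Vec.lookup R p ⟩ r r′))
  (∣pos-pos-+∣ (⟨ Vec.lookup R p ⟩ r r′) (⟨ Vec.lookup R (p +ₘ 1) ⟩ r r′)
    (trans (cong (λ y → ⟨ y ⟩ r r′) eq) (⟨⟩-⊕ (Vec.lookup R (p +ₘ 1)) x r r′)))

SpreadRow : ∀ {k} → Form → Row k → Set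
SpreadRow b R = SpreadForms b (Vec.lookup R) × SpreadForms b (midForms R)

spreadRow? : ∀ {k} b (R : Row k) → Dec (SpreadRow b R)
spreadRow? b R = spreadForms? b (Vec.lookup R) ×-dec spreadForms? b (midForms R)

realise-spread : ∀ {k} b (R : Row k) r r′ {N} → ⟨ b ⟩ r r′ ≡ N → SpreadRow b R →
  Spread N (realise R r r′) × Spread N (mids (realise R r r′))
realise-spread b R r r′ refl (base , mid) =
  spreadForms-sound {b = b} {Vec.lookup R} r r′ base ,
  spread-cong (realise-mids R r r′) (spreadForms-sound {b = b} {midForms R} r r′ mid)

-- Tables and their finite check

-- A table prescribes, for every m, s + m f base cycles: the singles with r = m and r′ = 0,
-- and the families once for every r < m with r + r′ + 1 = m.
-- A row lists the vertices of a cycle, shifted so that no coefficient is negative.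
record Table (k s f : ℕ) : Set where
  field
    singles  : Vec (Row k) s
    families : Vec (Row k) f

  Single : ℕ → ℕ → Set
  Single a b = ∃₂ λ i p → StepIs (Vec.lookup singles i) p (a , b , 0)

  -- With m = r + r′ + 1 these forms are a + b m + j + t r and a + b m + j + t r′.
  Residue : (a b t j : ℕ) → Set
  Residue a b t j = ∃₂ λ i p → StepIs (Vec.lookup families i) p (a + b + j , b + t , b)
                             ⊎ StepIs (Vec.lookup families i) p (a + b + j , b , b + t)

  -- The list cuts the integers from a + b m up to the number of edges into blocks: 0 is a block
  -- with one element, taken from a single, and t > 0 is one with t m elements, made up of t
  -- progressions of length m taken from the families.
  Cover : List ℕ → ℕ → ℕ → Set
  Cover []               a b = a ≡ suc (s * k) × b ≡ f * k
  Cover (0 ∷ ts)         a b = Single a b × Cover ts (suc a) b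
  Cover (t@(suc _) ∷ ts) a b = (∀ (j : Fin t) → Residue a b t (toℕ j)) × Cover ts a (b + t)

  cover? : ∀ ts a b → Dec (Cover ts a b)
  cover? []               a b = (a ℕ.≟ suc (s * k)) ×-dec (b ℕ.≟ f * k)
  cover? (0 ∷ ts)         a b =
    (any? λ i → any? λ p → stepIs? (Vec.lookup singles i) p (a , b , 0)) ×-dec cover? ts (suc a) b
  cover? (t@(suc _) ∷ ts) a b = (all? λ j → any? λ i → any? λ p →
      stepIs? (Vec.lookup families i) p (a + b + toℕ j , b + t , b) ⊎-dec
      stepIs? (Vec.lookup families i) p (a + b + toℕ j , b , b + t))
    ×-dec cover? ts a (b + t)

  -- Both stand for 2nk with `n = s + m * f`, once with `m = r` and once with `m = r + r′ + 1`.
  singleBound familyBound : Form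
  singleBound = 2 * (s * k) , 2 * (f * k) , 0
  familyBound = 2 * ((s + f) * k) , 2 * (f * k) , 2 * (f * k)

  Valid : List ℕ → Set
  Valid ts = Cover ts 1 0 × (∀ i → SpreadRow singleBound (Vec.lookup singles i))
                          × (∀ i → SpreadRow familyBound (Vec.lookup families i))

  valid? : ∀ ts → Dec (Valid ts)
  valid? ts = cover? ts 1 0 ×-dec (all? λ i → spreadRow? singleBound (Vec.lookup singles i))
                            ×-dec (all? λ i → spreadRow? familyBound (Vec.lookup families i))

complement : ∀ {m} (r : Fin m) → m ≡ suc (toℕ r + (m ∸ suc (toℕ r)))
complement r = sym (ℕ.m+[n∸m]≡n (toℕ<n r))

-- From a valid table to starters

module _ {k s f : ℕ} (T : Table k s f) (m : ℕ) where
  open Table T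

  fromSingle : Fin s → Fin k → ℤ
  fromSingle i = realise (Vec.lookup singles i) m 0

  fromFamily : Fin m × Fin f → Fin k → ℤ
  fromFamily (r , i) = realise (Vec.lookup families i) (toℕ r) (m ∸ suc (toℕ r))

  tableBase : Fin (s + m * f) → Fin k → ℤ
  tableBase z = [ fromSingle , fromFamily ∘ remQuot {m} f ]′ (splitAt s z)

  tableBase-single : ∀ i → tableBase (i ↑ˡ (m * f)) ≡ fromSingle i
  tableBase-single i = cong [ fromSingle , fromFamily ∘ remQuot {m} f ]′ (splitAt-↑ˡ s i (m * f))

  tableBase-family : ∀ r i → tableBase (s ↑ʳ combine r i) ≡ fromFamily (r , i)
  tableBase-family r i = trans
    (cong [ fromSingle , fromFamily ∘ remQuot {m} f ]′ (splitAt-↑ʳ s (m * f) (combine r i)))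
    (cong fromFamily (remQuot-combine r i))

  tableBase-elim : (P : (Fin k → ℤ) → Set) →
    (∀ i → P (fromSingle i)) → (∀ c → P (fromFamily c)) → ∀ z → P (tableBase z)
  tableBase-elim P single family z with splitAt s z
  ... | inj₁ i = single i
  ... | inj₂ c = family (remQuot {m} f c)

  singleBound-sound : ⟨ singleBound ⟩ m 0 ≡ 2 * ((s + m * f) * k)
  singleBound-sound = eq s k f m
    where
    eq : ∀ s k f m → 2 * (s * k) + 2 * (f * k) * m + 0 ≡ 2 * ((s + m * f) * k)
    eq = ℕSolver.solve-∀

  familyBound-sound : ∀ (r : Fin m) → ⟨ familyBound ⟩ (toℕ r) (m ∸ suc (toℕ r)) ≡ 2 * ((s + m * f) * k)
  familyBound-sound r = trans (eq s k f (toℕ r) (m ∸ suc (toℕ r)))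
    (cong (λ m → 2 * ((s + m * f) * k)) (sym (complement r)))
    where
    eq : ∀ s k f r r′ →
      2 * ((s + f) * k) + 2 * (f * k) * r + 2 * (f * k) * r′ ≡ 2 * ((s + suc (r + r′) * f) * k)
    eq = ℕSolver.solve-∀

  Covered : ℕ → Set
  Covered d = ∃₂ λ z p → ∣ steps (tableBase z) p ∣ ≡ d

  single-covered : ∀ {a b} → Single a b → Covered (a + b * m)
  single-covered {a} {b} (i , p , step) = i ↑ˡ (m * f) , p ,
    trans (cong (λ c → ∣ steps c p ∣) (tableBase-single i))
      (trans (stepIs-sound (Vec.lookup singles i) p (a , b , 0) m 0 step) (ℕ.+-identityʳ (a + b * m)))

  family-covered : ∀ {x i p} r → StepIs (Vec.lookup families i) p x →
    Covered (⟨ x ⟩ (toℕ r) (m ∸ suc (toℕ r)))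
  family-covered {x} {i} {p} r step = s ↑ʳ combine r i , p ,
    trans (cong (λ c → ∣ steps c p ∣) (tableBase-family r i))
      (stepIs-sound (Vec.lookup families i) p x (toℕ r) (m ∸ suc (toℕ r)) step)

  -- A progression may run through its family forwards, with its term number `q` at `r = q`, or
  -- backwards, at `r′ = q`. A nested pair has one of each kind: its lower entry falls as its upper
  -- entry rises.
  residue-covered : ∀ {a b t j} q → q < m → Residue a b t j → Covered (a + b * m + (j + q * t))
  residue-covered {a} {b} {t} {j} q q<m (i , p , inj₁ step) =
    subst Covered value (family-covered {x = a + b + j , b + t , b} r step)
    where
    r = fromℕ< q<m
    r′ = m ∸ suc (toℕ r)
    eq : ∀ a b t j r r′ → (a + b + j) + (b + t) * r + b * r′ ≡ a + b * suc (r + r′) + (j + r * t)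
    eq = ℕSolver.solve-∀
    value : ⟨ a + b + j , b + t , b ⟩ (toℕ r) r′ ≡ a + b * m + (j + q * t)
    value = trans (eq a b t j (toℕ r) r′)
      (cong₂ (λ m q → a + b * m + (j + q * t)) (sym (complement r)) (toℕ-fromℕ< q<m))
  residue-covered {a} {b} {t} {j} q q<m (i , p , inj₂ step) =
    subst Covered value (family-covered {x = a + b + j , b , b + t} r step)
    where
    -- The cycle with `r = m − 1 − q`, so that `r′ = q`.
    r = opposite (fromℕ< q<m)
    r′ = m ∸ suc (toℕ r)
    toℕ-r : toℕ r ≡ m ∸ suc q
    toℕ-r = trans (opposite-prop (fromℕ< q<m)) (cong (λ q → m ∸ suc q) (toℕ-fromℕ< q<m))
    r′≡q : r′ ≡ q
    r′≡q = ℕ.+-cancelˡ-≡ (suc (toℕ r)) r′ q (trans (sym (complement r)) (sym (begin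
      suc (toℕ r + q)      ≡⟨ cong suc (ℕ.+-comm (toℕ r) q) ⟩
      suc q + toℕ r        ≡⟨ cong (λ h → suc q + h) toℕ-r ⟩
      suc q + (m ∸ suc q)  ≡⟨ ℕ.m+[n∸m]≡n q<m ⟩
      m                    ∎)))
      where open ≡-Reasoning
    eq : ∀ a b t j r r′ → (a + b + j) + b * r + (b + t) * r′ ≡ a + b * suc (r + r′) + (j + r′ * t)
    eq = ℕSolver.solve-∀
    value : ⟨ a + b + j , b , b + t ⟩ (toℕ r) r′ ≡ a + b * m + (j + q * t)
    value = trans (eq a b t j (toℕ r) r′)
      (cong₂ (λ m q → a + b * m + (j + q * t)) (sym (complement r)) r′≡q)

  cover-sound : ∀ ts {a b} → Cover ts a b →
    ∀ d → a + b * m ≤ d → d < suc (s * k) + f * k * m → Covered d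
  cover-sound [] (refl , refl) d lower upper = contradiction upper (ℕ.≤⇒≯ lower)
  cover-sound (0 ∷ ts) {a} {b} (single , rest) d lower upper with ℕ.m≤n⇒m<n∨m≡n lower
  ... | inj₁ a+bm<d = cover-sound ts rest d a+bm<d upper
  ... | inj₂ refl   = single-covered {a} {b} single
  cover-sound (t@(suc _) ∷ ts) {a} {b} (residues , rest) d lower upper with d ℕ.<? a + (b + t) * m
  ... | no ¬inside = cover-sound ts rest d (ℕ.≮⇒≥ ¬inside) upper
  ... | yes inside = subst Covered value
    (residue-covered {a} {b} {t} {e % t} (e / t) (m<n*o⇒m/o<n e<m*t) residue)
    where
    -- The offset in a block of `t * m` numbers: its remainder modulo `t` selects the progression,
    -- its quotient the term.
    e = d ∸ (a + b * m)
    e<m*t : e < m * t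
    e<m*t = ℕ.+-cancelˡ-< (a + b * m) e (m * t) (begin-strict
      a + b * m + e      ≡⟨ ℕ.m+[n∸m]≡n lower ⟩
      d                  <⟨ inside ⟩
      a + (b + t) * m    ≡⟨ eq a b t m ⟩
      a + b * m + m * t  ∎)
      where
      open ℕ.≤-Reasoning
      eq : ∀ a b t m → a + (b + t) * m ≡ a + b * m + m * t
      eq = ℕSolver.solve-∀
    residue : Residue a b t (e % t)
    residue = subst (Residue a b t) (toℕ-fromℕ< (m%n<n e t)) (residues (fromℕ< (m%n<n e t)))
    value : a + b * m + (e % t + (e / t) * t) ≡ d
    value = trans (cong (λ h → a + b * m + h) (sym (m≡m%n+[m/n]*n e t))) (ℕ.m+[n∸m]≡n lower)

  tableStarter : ∀ {ts} → Valid ts → Starter (s + m * f) k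
  tableStarter {ts} (cover , singles-spread , families-spread) = record
    { base        = tableBase
    ; covers      = λ d 1≤d d≤N →
        cover-sound ts cover d 1≤d (s≤s (subst (d ≤_) (eq s k f m) d≤N))
    ; base-spread = λ z → proj₁ (row-spread z)
    ; mids-spread = λ z → proj₂ (row-spread z)
    }
    where
    N = 2 * ((s + m * f) * k)
    eq : ∀ s k f m → (s + m * f) * k ≡ s * k + f * k * m
    eq = ℕSolver.solve-∀
    row-spread : ∀ z → Spread N (tableBase z) × Spread N (mids (tableBase z))
    row-spread = tableBase-elim (λ c → Spread N c × Spread N (mids c))
      (λ i → realise-spread singleBound (Vec.lookup singles i) m 0 singleBound-sound (singles-spread i))
      (λ (r , i) → realise-spread familyBound (Vec.lookup families i) (toℕ r) (m ∸ suc (toℕ r))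
        (familyBound-sound r) (families-spread i))

-- Validity does not mention `m`: the hidden argument is filled by evaluating `valid?` once, for all
-- `m`.
starter : ∀ {k s f} (T : Table k s f) ts {_ : True (Table.valid? T ts)} m → Starter (s + m * f) k
starter T ts {valid} m = tableStarter T m (toWitness valid)

-- For k = 3 the differences of a base cycle satisfy x + y = z, the pairs y, z being nested as in a
-- Skolem sequence. For k = 5 two of the differences form such a nested pair, and two others a pair
-- at a bounded distance that makes up for the discrepancy between the nested pair and the fifth;
-- for n = 4m + 3 the three singles use up the numbers left over. For k = 4 and k = 6 the cycles
-- split the integers into runs of 4 and of 12. The cycles for k + 4 are those for k with four
-- further consecutive differences. The order of the vertices in each row was found by search.
T3-4+4m : Table 3 4 4
T3-4+4m = record
  { singles  =
    ( ((0 , 0 , 0) ∷ (4 , 4 , 0) ∷ (12 , 12 , 0) ∷ [])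
    ∷ ((0 , 0 , 0) ∷ (1 , 2 , 0) ∷ (11 , 12 , 0) ∷ [])
    ∷ ((0 , 0 , 0) ∷ (3 , 4 , 0) ∷ (9 , 9 , 0) ∷ [])
    ∷ ((0 , 0 , 0) ∷ (2 , 4 , 0) ∷ (7 , 8 , 0) ∷ [])
    ∷ [] )
  ; families =
    ( ((0 , 0 , 0) ∷ (1 , 2 , 0) ∷ (13 , 7 , 6) ∷ [])
    ∷ ((0 , 0 , 0) ∷ (4 , 4 , 2) ∷ (14 , 8 , 7) ∷ [])
    ∷ ((0 , 0 , 0) ∷ (2 , 2 , 0) ∷ (21 , 11 , 10) ∷ [])
    ∷ ((0 , 0 , 0) ∷ (5 , 4 , 2) ∷ (22 , 12 , 11) ∷ [])
    ∷ [] )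
  }

-- The blocks `2` hold the smallest differences of the four families, the eight blocks `1` the lower
-- and upper entries of their nested pairs; the singles fill the gaps.
T3-4+4m-starter : ∀ m → Starter (4 + m * 4) 3
T3-4+4m-starter = starter T3-4+4m
  (2 ∷ 0 ∷ 2 ∷ 0 ∷ 0 ∷ 0 ∷ 0 ∷ 1 ∷ 0 ∷ 1 ∷ 1 ∷ 1 ∷ 0 ∷ 0 ∷ 1 ∷ 0 ∷ 1 ∷ 0 ∷ 1 ∷ 1 ∷ 0 ∷ 0 ∷ [])

T3-5+4m : Table 3 5 4
T3-5+4m = record
  { singles  =
    ( ((0 , 0 , 0) ∷ (2 , 2 , 0) ∷ (15 , 12 , 0) ∷ [])
    ∷ ((0 , 0 , 0) ∷ (3 , 4 , 0) ∷ (14 , 12 , 0) ∷ [])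
    ∷ ((0 , 0 , 0) ∷ (5 , 4 , 0) ∷ (12 , 9 , 0) ∷ [])
    ∷ ((0 , 0 , 0) ∷ (4 , 4 , 0) ∷ (10 , 8 , 0) ∷ [])
    ∷ ((0 , 0 , 0) ∷ (1 , 2 , 0) ∷ (9 , 7 , 0) ∷ [])
    ∷ [] )
  ; families =
    ( ((0 , 0 , 0) ∷ (1 , 2 , 0) ∷ (15 , 7 , 6) ∷ [])
    ∷ ((0 , 0 , 0) ∷ (6 , 4 , 2) ∷ (17 , 8 , 7) ∷ [])
    ∷ ((0 , 0 , 0) ∷ (2 , 2 , 0) ∷ (24 , 11 , 10) ∷ [])
    ∷ ((0 , 0 , 0) ∷ (5 , 4 , 2) ∷ (25 , 12 , 11) ∷ [])
    ∷ [] )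
  }

T3-5+4m-starter : ∀ m → Starter (5 + m * 4) 3
T3-5+4m-starter = starter T3-5+4m
  (2 ∷ 0 ∷ 0 ∷ 2 ∷ 0 ∷ 0 ∷ 0 ∷ 0 ∷ 1 ∷ 0 ∷ 0 ∷ 1 ∷ 1 ∷ 0 ∷ 1 ∷ 0 ∷ 0 ∷ 1 ∷ 0 ∷ 1 ∷ 0 ∷ 1 ∷ 1 ∷
   0 ∷ 0 ∷ [])

T3-1 : Table 3 1 0
T3-1 = record
  { singles  =
    ( ((0 , 0 , 0) ∷ (1 , 0 , 0) ∷ (3 , 0 , 0) ∷ [])
    ∷ [] )
  ; families = []
  }

T3-1-starter : ∀ m → Starter (1 + m * 0) 3
T3-1-starter = starter T3-1 (0 ∷ 0 ∷ 0 ∷ [])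

-- Four consecutive integers always close up, as 1 - 2 - 3 + 4 = 0 with as many plus as minus signs.
T4-m : Table 4 0 1
T4-m = record
  { singles  = []
  ; families =
    ( ((4 , 4 , 0) ∷ (5 , 8 , 0) ∷ (3 , 4 , 0) ∷ (0 , 0 , 0) ∷ [])
    ∷ [] )
  }

T4-m-starter : ∀ m → Starter (0 + m * 1) 4
T4-m-starter = starter T4-m (4 ∷ [])

T5-4m : Table 5 0 4
T5-4m = record
  { singles  = []
  ; families =
    ( ((19 , 20 , 16) ∷ (21 , 28 , 16) ∷ (8 , 12 , 4) ∷ (17 , 20 , 16) ∷ (0 , 0 , 0) ∷ [])
    ∷ ((6 , 8 , 0) ∷ (9 , 16 , 0) ∷ (19 , 24 , 12) ∷ (5 , 8 , 0) ∷ (0 , 0 , 0) ∷ [])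
    ∷ ((20 , 20 , 16) ∷ (21 , 28 , 16) ∷ (6 , 12 , 4) ∷ (18 , 20 , 16) ∷ (0 , 0 , 0) ∷ [])
    ∷ ((8 , 8 , 0) ∷ (12 , 16 , 0) ∷ (23 , 24 , 12) ∷ (7 , 8 , 0) ∷ (0 , 0 , 0) ∷ [])
    ∷ [] )
  }

-- The block `8` holds the fifth differences and two of the pairs at bounded distance, the last `4`
-- the other two pairs; the middle blocks hold the lower and the upper entries of the nested pairs.
T5-4m-starter : ∀ m → Starter (0 + m * 4) 5
T5-4m-starter = starter T5-4m (8 ∷ 4 ∷ 4 ∷ 4 ∷ [])

T5-3+4m : Table 5 3 4
T5-3+4m = record
  { singles  =
    ( ((10 , 20 , 0) ∷ (11 , 28 , 0) ∷ (4 , 8 , 0) ∷ (8 , 20 , 0) ∷ (0 , 0 , 0) ∷ [])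
    ∷ ((14 , 20 , 0) ∷ (16 , 28 , 0) ∷ (7 , 8 , 0) ∷ (12 , 20 , 0) ∷ (0 , 0 , 0) ∷ [])
    ∷ ((4 , 0 , 0) ∷ (7 , 8 , 0) ∷ (13 , 20 , 0) ∷ (0 , 0 , 0) ∷ (15 , 20 , 0) ∷ [])
    ∷ [] )
  ; families =
    ( ((8 , 8 , 0) ∷ (11 , 16 , 0) ∷ (23 , 24 , 12) ∷ (4 , 8 , 0) ∷ (0 , 0 , 0) ∷ [])
    ∷ ((5 , 4 , 4) ∷ (10 , 12 , 4) ∷ (23 , 20 , 16) ∷ (0 , 0 , 0) ∷ (25 , 20 , 16) ∷ [])
    ∷ ((7 , 8 , 0) ∷ (8 , 16 , 0) ∷ (23 , 24 , 12) ∷ (2 , 8 , 0) ∷ (0 , 0 , 0) ∷ [])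
    ∷ ((4 , 4 , 4) ∷ (10 , 12 , 4) ∷ (24 , 20 , 16) ∷ (0 , 0 , 0) ∷ (26 , 20 , 16) ∷ [])
    ∷ [] )
  }

T5-3+4m-starter : ∀ m → Starter (3 + m * 4) 5
T5-3+4m-starter = starter T5-3+4m (8 ∷ 0 ∷ 0 ∷ 0 ∷ 4 ∷ 0 ∷ 0 ∷ 0 ∷ 4 ∷ 4 ∷ replicate 9 0)

-- Six consecutive integers have an odd sum and cannot close up. Two rows therefore share a run of
-- twelve, split into 1, 2, 3, 4, 5, 7 and 6, 8, ..., 12, both with even sum; three signs of each
-- kind cancel the shift 12r.
T6-2m : Table 6 0 2
T6-2m = record
  { singles  = []
  ; families =
    ( ((5 , 12 , 0) ∷ (6 , 24 , 0) ∷ (4 , 12 , 0) ∷ (0 , 0 , 0) ∷ (3 , 12 , 0) ∷ (10 , 24 , 0) ∷ [])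
    ∷ ((11 , 12 , 0) ∷ (17 , 24 , 0) ∷ (9 , 12 , 0) ∷
       (0 , 0 , 0) ∷ (10 , 12 , 0) ∷ (22 , 24 , 0) ∷ [])
    ∷ [] )
  }

T6-2m-starter : ∀ m → Starter (0 + m * 2) 6
T6-2m-starter = starter T6-2m (12 ∷ [])

T7-4+4m : Table 7 4 4
T7-4+4m = record
  { singles  =
    ( ((22 , 36 , 0) ∷ (26 , 40 , 0) ∷ (14 , 28 , 0) ∷ (0 , 0 , 0) ∷
       (13 , 28 , 0) ∷ (21 , 36 , 0) ∷ (6 , 8 , 0) ∷ [])
    ∷ ((1 , 0 , 0) ∷ (2 , 2 , 0) ∷ (12 , 12 , 0) ∷ (29 , 40 , 0) ∷
       (11 , 12 , 0) ∷ (0 , 0 , 0) ∷ (20 , 28 , 0) ∷ [])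
    ∷ ((1 , 0 , 0) ∷ (4 , 4 , 0) ∷ (10 , 9 , 0) ∷ (31 , 37 , 0) ∷
       (9 , 9 , 0) ∷ (0 , 0 , 0) ∷ (24 , 28 , 0) ∷ [])
    ∷ ((1 , 0 , 0) ∷ (3 , 4 , 0) ∷ (8 , 8 , 0) ∷ (33 , 36 , 0) ∷
       (7 , 8 , 0) ∷ (0 , 0 , 0) ∷ (28 , 28 , 0) ∷ [])
    ∷ [] )
  ; families =
    ( ((1 , 0 , 0) ∷ (2 , 2 , 0) ∷ (14 , 7 , 6) ∷ (39 , 35 , 18) ∷
       (13 , 7 , 6) ∷ (0 , 0 , 0) ∷ (28 , 28 , 12) ∷ [])
    ∷ ((1 , 0 , 0) ∷ (5 , 4 , 2) ∷ (15 , 8 , 7) ∷ (44 , 36 , 19) ∷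
       (14 , 8 , 7) ∷ (0 , 0 , 0) ∷ (32 , 28 , 12) ∷ [])
    ∷ ((1 , 0 , 0) ∷ (3 , 2 , 0) ∷ (22 , 11 , 10) ∷ (55 , 39 , 22) ∷
       (21 , 11 , 10) ∷ (0 , 0 , 0) ∷ (36 , 28 , 12) ∷ [])
    ∷ ((55 , 36 , 21) ∷ (60 , 40 , 23) ∷ (38 , 28 , 12) ∷ (0 , 0 , 0) ∷
       (37 , 28 , 12) ∷ (54 , 36 , 21) ∷ (15 , 8 , 9) ∷ [])
    ∷ [] )
  }

-- The blocks of `T3-4+4m-starter`, then four new differences for each family cycle (the block `16`)
-- and for each single (the zeros).
T7-4+4m-starter : ∀ m → Starter (4 + m * 4) 7
T7-4+4m-starter = starter T7-4+4m
  (2 ∷ 0 ∷ 2 ∷ 0 ∷ 0 ∷ 0 ∷ 0 ∷ 1 ∷ 0 ∷ 1 ∷ 1 ∷ 1 ∷ 0 ∷ 0 ∷ 1 ∷ 0 ∷ 1 ∷ 0 ∷ 1 ∷ 1 ∷ 0 ∷ 0 ∷ 16 ∷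
   replicate 16 0)

T7-5+4m : Table 7 5 4
T7-5+4m = record
  { singles  =
    ( ((30 , 38 , 0) ∷ (32 , 40 , 0) ∷ (17 , 28 , 0) ∷ (0 , 0 , 0) ∷
       (16 , 28 , 0) ∷ (29 , 38 , 0) ∷ (11 , 10 , 0) ∷ [])
    ∷ ((1 , 0 , 0) ∷ (4 , 4 , 0) ∷ (15 , 12 , 0) ∷ (35 , 40 , 0) ∷
       (14 , 12 , 0) ∷ (0 , 0 , 0) ∷ (23 , 28 , 0) ∷ [])
    ∷ ((1 , 0 , 0) ∷ (6 , 4 , 0) ∷ (13 , 9 , 0) ∷ (37 , 37 , 0) ∷
       (12 , 9 , 0) ∷ (0 , 0 , 0) ∷ (27 , 28 , 0) ∷ [])
    ∷ ((1 , 0 , 0) ∷ (5 , 4 , 0) ∷ (11 , 8 , 0) ∷ (39 , 36 , 0) ∷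
       (10 , 8 , 0) ∷ (0 , 0 , 0) ∷ (31 , 28 , 0) ∷ [])
    ∷ ((1 , 0 , 0) ∷ (2 , 2 , 0) ∷ (10 , 7 , 0) ∷ (42 , 35 , 0) ∷
       (9 , 7 , 0) ∷ (0 , 0 , 0) ∷ (35 , 28 , 0) ∷ [])
    ∷ [] )
  ; families =
    ( ((1 , 0 , 0) ∷ (2 , 2 , 0) ∷ (16 , 7 , 6) ∷ (44 , 35 , 18) ∷
       (15 , 7 , 6) ∷ (0 , 0 , 0) ∷ (31 , 28 , 12) ∷ [])
    ∷ ((1 , 0 , 0) ∷ (7 , 4 , 2) ∷ (18 , 8 , 7) ∷ (50 , 36 , 19) ∷
       (17 , 8 , 7) ∷ (0 , 0 , 0) ∷ (35 , 28 , 12) ∷ [])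
    ∷ ((1 , 0 , 0) ∷ (3 , 2 , 0) ∷ (25 , 11 , 10) ∷ (61 , 39 , 22) ∷
       (24 , 11 , 10) ∷ (0 , 0 , 0) ∷ (39 , 28 , 12) ∷ [])
    ∷ ((61 , 36 , 21) ∷ (66 , 40 , 23) ∷ (41 , 28 , 12) ∷ (0 , 0 , 0) ∷
       (40 , 28 , 12) ∷ (60 , 36 , 21) ∷ (18 , 8 , 9) ∷ [])
    ∷ [] )
  }

T7-5+4m-starter : ∀ m → Starter (5 + m * 4) 7
T7-5+4m-starter = starter T7-5+4m
  (2 ∷ 0 ∷ 0 ∷ 2 ∷ 0 ∷ 0 ∷ 0 ∷ 0 ∷ 1 ∷ 0 ∷ 0 ∷ 1 ∷ 1 ∷ 0 ∷ 1 ∷ 0 ∷ 0 ∷ 1 ∷ 0 ∷ 1 ∷ 0 ∷ 1 ∷ 1 ∷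
   0 ∷ 0 ∷ 16 ∷ replicate 20 0)

T7-1 : Table 7 1 0
T7-1 = record
  { singles  =
    ( ((1 , 0 , 0) ∷ (2 , 0 , 0) ∷ (4 , 0 , 0) ∷ (8 , 0 , 0) ∷
       (5 , 0 , 0) ∷ (0 , 0 , 0) ∷ (7 , 0 , 0) ∷ [])
    ∷ [] )
  ; families = []
  }

T7-1-starter : ∀ m → Starter (1 + m * 0) 7
T7-1-starter = starter T7-1 (replicate 7 0)

T8-m : Table 8 0 1
T8-m = record
  { singles  = []
  ; families =
    ( ((6 , 8 , 0) ∷ (7 , 16 , 0) ∷ (4 , 8 , 0) ∷ (0 , 0 , 0) ∷
       (2 , 8 , 0) ∷ (10 , 16 , 0) ∷ (5 , 8 , 0) ∷ (12 , 16 , 0) ∷ [])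
    ∷ [] )
  }

T8-m-starter : ∀ m → Starter (0 + m * 1) 8
T8-m-starter = starter T8-m (8 ∷ [])

T9-4m : Table 9 0 4
T9-4m = record
  { singles  = []
  ; families =
    ( ((25 , 36 , 20) ∷ (27 , 44 , 20) ∷ (36 , 52 , 32) ∷ (23 , 36 , 20) ∷ (4 , 16 , 4) ∷
       (21 , 36 , 20) ∷ (0 , 0 , 0) ∷ (24 , 36 , 20) ∷ (47 , 72 , 40) ∷ [])
    ∷ ((27 , 36 , 20) ∷ (30 , 44 , 20) ∷ (40 , 52 , 32) ∷ (26 , 36 , 20) ∷ (20 , 28 , 20) ∷
       (25 , 36 , 20) ∷ (0 , 0 , 0) ∷ (28 , 36 , 20) ∷ (54 , 72 , 40) ∷ [])
    ∷ ((33 , 36 , 20) ∷ (34 , 44 , 20) ∷ (46 , 52 , 32) ∷ (31 , 36 , 20) ∷ (11 , 16 , 4) ∷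
       (29 , 36 , 20) ∷ (0 , 0 , 0) ∷ (32 , 36 , 20) ∷ (2 , 0 , 0) ∷ [])
    ∷ ((27 , 28 , 20) ∷ (31 , 36 , 20) ∷ (42 , 44 , 32) ∷ (26 , 28 , 20) ∷ (33 , 36 , 20) ∷
       (0 , 0 , 0) ∷ (34 , 36 , 20) ∷ (70 , 72 , 40) ∷ (35 , 36 , 20) ∷ [])
    ∷ [] )
  }

T9-4m-starter : ∀ m → Starter (0 + m * 4) 9
T9-4m-starter = starter T9-4m (8 ∷ 4 ∷ 4 ∷ 4 ∷ 16 ∷ [])

T9-3+4m : Table 9 3 4
T9-3+4m = record
  { singles  =
    ( ((20 , 36 , 0) ∷ (21 , 44 , 0) ∷ (25 , 56 , 0) ∷ (18 , 36 , 0) ∷ (26 , 56 , 0) ∷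
       (16 , 36 , 0) ∷ (0 , 0 , 0) ∷ (19 , 36 , 0) ∷ (2 , 0 , 0) ∷ [])
    ∷ ((24 , 36 , 0) ∷ (26 , 44 , 0) ∷ (31 , 56 , 0) ∷ (22 , 36 , 0) ∷ (34 , 56 , 0) ∷
       (20 , 36 , 0) ∷ (0 , 0 , 0) ∷ (23 , 36 , 0) ∷ (2 , 0 , 0) ∷ [])
    ∷ ((28 , 36 , 0) ∷ (31 , 44 , 0) ∷ (37 , 56 , 0) ∷ (26 , 36 , 0) ∷ (11 , 16 , 0) ∷
       (24 , 36 , 0) ∷ (0 , 0 , 0) ∷ (27 , 36 , 0) ∷ (2 , 0 , 0) ∷ [])
    ∷ [] )
  ; families =
    ( ((4 , 0 , 0) ∷ (7 , 8 , 0) ∷ (19 , 16 , 12) ∷ (0 , 0 , 0) ∷ (8 , 8 , 0) ∷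
       (44 , 44 , 20) ∷ (40 , 36 , 20) ∷ (3 , 0 , 0) ∷ (42 , 36 , 20) ∷ [])
    ∷ ((44 , 36 , 20) ∷ (49 , 44 , 20) ∷ (62 , 52 , 32) ∷ (42 , 36 , 20) ∷ (17 , 16 , 4) ∷
       (40 , 36 , 20) ∷ (0 , 0 , 0) ∷ (43 , 36 , 20) ∷ (2 , 0 , 0) ∷ [])
    ∷ ((5 , 0 , 0) ∷ (6 , 8 , 0) ∷ (21 , 16 , 12) ∷ (0 , 0 , 0) ∷ (7 , 8 , 0) ∷
       (51 , 44 , 20) ∷ (49 , 36 , 20) ∷ (3 , 0 , 0) ∷ (50 , 36 , 20) ∷ [])
    ∷ ((52 , 36 , 20) ∷ (58 , 44 , 20) ∷ (72 , 52 , 32) ∷ (50 , 36 , 20) ∷ (24 , 16 , 4) ∷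
       (48 , 36 , 20) ∷ (0 , 0 , 0) ∷ (51 , 36 , 20) ∷ (2 , 0 , 0) ∷ [])
    ∷ [] )
  }

T9-3+4m-starter : ∀ m → Starter (3 + m * 4) 9
T9-3+4m-starter = starter T9-3+4m
  (8 ∷ 0 ∷ 0 ∷ 0 ∷ 4 ∷ 0 ∷ 0 ∷ 0 ∷ 4 ∷ 4 ∷ replicate 9 0 ++ 16 ∷ replicate 12 0)

-- A run of ten again has an odd sum. The two sets used for k = 6 are enlarged by 13, ..., 16 and
-- 17, ..., 20, with shift 20r.
T10-2m : Table 10 0 2
T10-2m = record
  { singles  = []
  ; families =
    ( ((17 , 20 , 0) ∷ (18 , 40 , 0) ∷ (15 , 20 , 0) ∷ (11 , 0 , 0) ∷ (13 , 20 , 0) ∷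
       (0 , 0 , 0) ∷ (14 , 20 , 0) ∷ (9 , 0 , 0) ∷ (16 , 20 , 0) ∷ (1 , 0 , 0) ∷ [])
    ∷ ((11 , 0 , 0) ∷ (17 , 20 , 0) ∷ (25 , 40 , 0) ∷ (16 , 20 , 0) ∷ (6 , 0 , 0) ∷
       (18 , 20 , 0) ∷ (0 , 0 , 0) ∷ (20 , 20 , 0) ∷ (3 , 0 , 0) ∷ (22 , 20 , 0) ∷ [])
    ∷ [] )
  }

T10-2m-starter : ∀ m → Starter (0 + m * 2) 10
T10-2m-starter = starter T10-2m (20 ∷ [])

-- Choice of a table by the residue of `n` modulo 4

Admissible : ℕ → ℕ → Set
Admissible k n = (n * k) % 4 ≡ 0 ⊎ (n * k) % 4 ≡ 3

admissible-mod-4 : ∀ {k} c q → Admissible k (c + q * 4) → Admissible k c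
admissible-mod-4 {k} c q = map (trans (sym same-residue)) (trans (sym same-residue))
  where
  eq : ∀ c q k → (c + q * 4) * k ≡ c * k + q * k * 4
  eq = ℕSolver.solve-∀
  same-residue : ((c + q * 4) * k) % 4 ≡ (c * k) % 4
  same-residue = trans (cong (_% 4) (eq c q k)) ([m+kn]%n≡m%n (c * k) (q * k) 4)

by-residue : ∀ {k} {P : ℕ → Set} →
  ((c : Fin 4) → Admissible k (toℕ c) → ∀ q → 1 ≤ toℕ c + q * 4 → P (toℕ c + q * 4)) →
  ∀ n → 1 ≤ n → Admissible k n → P n
by-residue P-class n 1≤n admissible with n divMod 4
... | result q c refl = P-class c (admissible-mod-4 (toℕ c) q admissible) q 1≤n

starters : ∀ k → 3 ≤ k → k ≤ 10 → ∀ n → 1 ≤ n → Admissible k n → Starter n k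
starters 0 ()
starters 1 (s≤s ())
starters 2 (s≤s (s≤s ()))
starters 3 _ _ = by-residue λ where
  0F _ (suc q) _ → T3-4+4m-starter q
  -- `n = 1` lies below the range `5 + 4m` of the general table.
  1F _ zero    _ → T3-1-starter 0
  1F _ (suc q) _ → T3-5+4m-starter q
  2F (inj₁ ())
  2F (inj₂ ())
  3F (inj₁ ())
  3F (inj₂ ())
starters 4 _ _ n _ _ = subst (λ n → Starter n 4) (ℕ.*-identityʳ n) (T4-m-starter n)
starters 5 _ _ = by-residue λ where
  0F _ q _ → T5-4m-starter q
  1F (inj₁ ())
  1F (inj₂ ())
  2F (inj₁ ())
  2F (inj₂ ())
  3F _ q _ → T5-3+4m-starter q
starters 6 _ _ = by-residue λ where
  -- Admissible means even here, and the table has `n = 2m`: for `n = 4q` take `m = 2q`, for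
  -- `n = 4q + 2` take `m = 2q + 1`.
  0F _ q _ → subst (λ n → Starter n 6) (ℕ.*-assoc q 2 2) (T6-2m-starter (q * 2))
  1F (inj₁ ())
  1F (inj₂ ())
  2F _ q _ → subst (λ n → Starter (2 + n) 6) (ℕ.*-assoc q 2 2) (T6-2m-starter (suc (q * 2)))
  3F (inj₁ ())
  3F (inj₂ ())
starters 7 _ _ = by-residue λ where
  0F _ (suc q) _ → T7-4+4m-starter q
  1F _ zero    _ → T7-1-starter 0
  1F _ (suc q) _ → T7-5+4m-starter q
  2F (inj₁ ())
  2F (inj₂ ())
  3F (inj₁ ())
  3F (inj₂ ())
starters 8 _ _ n _ _ = subst (λ n → Starter n 8) (ℕ.*-identityʳ n) (T8-m-starter n)
starters 9 _ _ = by-residue λ where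
  0F _ q _ → T9-4m-starter q
  1F (inj₁ ())
  1F (inj₂ ())
  2F (inj₁ ())
  2F (inj₂ ())
  3F _ q _ → T9-3+4m-starter q
starters 10 _ _ = by-residue λ where
  0F _ q _ → subst (λ n → Starter n 10) (ℕ.*-assoc q 2 2) (T10-2m-starter (q * 2))
  1F (inj₁ ())
  1F (inj₂ ())
  2F _ q _ → subst (λ n → Starter (2 + n) 10) (ℕ.*-assoc q 2 2) (T10-2m-starter (suc (q * 2)))
  3F (inj₁ ())
  3F (inj₂ ())
starters (suc (suc (suc (suc (suc (suc (suc (suc (suc (suc (suc k))))))))))) _
  (s≤s (s≤s (s≤s (s≤s (s≤s (s≤s (s≤s (s≤s (s≤s (s≤s ()))))))))))

theorem1p9 : (k : ℕ) → 3 ≤ k → k ≤ 10 →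
    (n : ℕ) → 1 ≤ n → ((n * k) % 4 ≡ 0 ⊎ (n * k) % 4 ≡ 3) →
    HasOrthogonalCyclicPair k (Complete (2 * n * k + 1))
    × HasOrthogonalCyclicPair k (CocktailParty (n * k + 1))
theorem1p9 k@(suc k′) 3≤k k≤10 n 1≤n admissible =
  orthogonal-pairs n k′ (starters k 3≤k k≤10 n 1≤n admissible)
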